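{- There is a universal constant $c \ge 1$ such that, for all sufficiently large depths $d$ and all composite $m$ with $r$ prime factors, every symmetric Boolean function on $n$ bits can be computed by a circuit consisting of $\text{MOD}_m$ gates, of depth $d$ and size $\exp(O(n^{c/((d-c)(r-1))}))$.
   Context: A Boolean function $f:\{0,1\}^n\to\{0,1\}$ is symmetric if $f(\mathbf{x})$ depends only on the number of ones in $\mathbf{x}$. A $\text{MOD}_m$ gate has unbounded fan-in and outputs $1$ iff the sum of its Boolean inputs (counted with multiplicity of wires) is divisible by $m$. Circuits take the input variables (and constants) as inputs; size is the number of gates. The $O(\cdot)$ is as $n\to\infty$ with $d,m$ fixed. -}

module Defs where

open import Data.Nat using (ℕ; zero; suc; _+_; _⊔_)
open import Data.Nat.Divisibility using (_∣_; _∣?_)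
open import Data.Nat.Primality using (Prime)
open import Data.Bool using (Bool; true; false; if_then_else_)
open import Data.Fin using (Fin; fromℕ)
open import Data.Vec using (Vec; []; _∷_; _∷ʳ_; lookup; foldr)
open import Data.List using (List; map; length)
open import Data.Nat.ListAction using (sum)
open import Data.List.Membership.Propositional using (_∈_)
open import Data.List.Relation.Unary.Unique.Propositional using (Unique)
open import Data.Product using (Σ; _×_)
open import Function.Bundles using (_⇔_)
open import Relation.Nullary.Decidable using (⌊_⌋)
open import Relation.Binary.PropositionalEquality using (_≡_)

ones : ∀ {n} → Vec Bool n → ℕ
ones []          = 0
ones (true ∷ x)  = suc (ones x)
ones (false ∷ x) = ones x

Symmetric : ∀ {n} → (Vec Bool n → Bool) → Set
Symmetric {n} f = ∀ (x y : Vec Bool n) → ones x ≡ ones y → f x ≡ f y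

HasPrimeFactorCount : ℕ → ℕ → Set
HasPrimeFactorCount m r =
  Σ (List ℕ) λ ps → Unique ps × length ps ≡ r ×
    (∀ p → (p ∈ ps) ⇔ (Prime p × p ∣ m))

data Wire (n k : ℕ) : Set where
  var   : Fin n → Wire n k
  const : Bool → Wire n k
  gate  : Fin k → Wire n k

-- A gate is given by its multiset (list, with repetition = multiplicity) of input wires.
Gate : ℕ → ℕ → Set
Gate n k = List (Wire n k)

-- A circuit on n inputs with k gates (a DAG, gates in topological order;
-- gate number j may only read from inputs, constants and gates 0 … j-1).
-- Size = number of gates = k.
data Circuit (n : ℕ) : ℕ → Set where
  []  : Circuit n 0
  _▷_ : ∀ {k} → Circuit n k → Gate n k → Circuit n (suc k)

b2n : Bool → ℕ
b2n true  = 1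
b2n false = 0

wireVal : ∀ {n k} → Vec Bool n → Vec Bool k → Wire n k → ℕ
wireVal x v (var i)   = b2n (lookup x i)
wireVal x v (const b) = b2n b
wireVal x v (gate j)  = b2n (lookup v j)

modGate : ∀ {n k} → ℕ → Vec Bool n → Vec Bool k → Gate n k → Bool
modGate m x v g = ⌊ m ∣? sum (map (wireVal x v) g) ⌋

gateValues : ∀ {n k} → ℕ → Circuit n k → Vec Bool n → Vec Bool k
gateValues m []      x = []
gateValues m (C ▷ g) x = let v = gateValues m C x in v ∷ʳ modGate m x v g

evalMod : ∀ {n k} → ℕ → Circuit n (suc k) → Vec Bool n → Bool
evalMod {k = k} m C x = lookup (gateValues m C x) (fromℕ k)

maxL : List ℕ → ℕ
maxL = Data.List.foldr _⊔_ 0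

wireDepth : ∀ {n k} → Vec ℕ k → Wire n k → ℕ
wireDepth ds (var i)   = 0
wireDepth ds (const b) = 0
wireDepth ds (gate j)  = lookup ds j

gateDepths : ∀ {n k} → Circuit n k → Vec ℕ k
gateDepths []      = []
gateDepths (C ▷ g) = let ds = gateDepths C in ds ∷ʳ suc (maxL (map (wireDepth ds) g))

depth : ∀ {n k} → Circuit n k → ℕ
depth C = foldr _ _⊔_ 0 (gateDepths C)

{-# OPTIONS --safe #-}

-- Write r for the number of primes dividing m and a = r − 1. Gates MOD_p with p ∣ m prime come from MOD_m by
-- repeating wires m/p times, and a conjunction of k bits is MOD_q ∘ MOD_p with pᵏ inner gates for primes p < q.
-- As C(s, i) mod p has period pᵉ in s for i < pᵉ, Newton interpolation makes [s ≡ t mod pᵉ] a polynomial of degree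
-- below pᵉ in the bits counted by s. With one power of about K^(1/r) for each of the r primes, the Chinese
-- remainder theorem then gives any symmetric function of K bits in depth 8 and size about exp(K^(1/r)).
-- To exploit the depth, write n < Bʰ and count modulo h coprime moduli ℓ of size O(B): modulo each ℓ, the number of
-- ones is computed by a B-ary tree of height h whose nodes add B numbers below ℓ in unary, a symmetric function of
-- only K = Bℓ bits; the h residues determine the count. Every depth being bounded, formulas suffice and their size
-- is controlled by the fan-in. With n ≈ j^(ah) and B = jᵃ the fan-in is exp(O(j³)), and h ≈ d/8 gives the bound.
module Submission where

open import Defs
open import Data.Bool using (Bool; true; false; not; _∧_)
open import Data.Bool.ListAction using (and)
open import Data.Empty using (⊥-elim)
open import Data.Fin using (Fin; fromℕ; inject₁)
open import Data.List as List using (List; []; _∷_; length; map; _++_)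
open import Data.List.Membership.Propositional using (_∈_)
open import Data.List.Properties
  using (map-∘; map-cong; map-++; map-tabulate; length-map; length-++; length-take; length-drop; length-tabulate; take++drop≡id)
open import Data.List.Relation.Unary.All as All using (All; []; _∷_)
import Data.List.Relation.Unary.All.Properties as All
open import Data.List.Relation.Unary.AllPairs as AllPairs using (AllPairs; []; _∷_)
import Data.List.Relation.Unary.AllPairs.Properties as AllPairs
open import Data.List.Relation.Unary.Any using (here; there)
open import Data.Nat
open import Data.Nat.Combinatorics
  using (nCn≡1; nC1≡n; nCk≡nC[n∸k]; k>n⇒nCk≡0; nCk+nC[k+1]≡[n+1]C[k+1]) renaming (_C_ to _choose_)
open import Data.Nat.Coprimality as Coprimality using (Coprime; coprime-divisor)
open import Data.Nat.DivMod
open import Data.Nat.Divisibility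
open import Data.Nat.ListAction using (sum; product)
open import Data.Nat.ListAction.Properties using (sum-++; ∈⇒∣product; product≢0; ∈⇒≤product)
open import Data.Nat.Primality
open import Data.Nat.Primality.Factorisation using (factorise; module PrimeFactorisation)
open import Data.Nat.Properties
open import Data.Nat.Tactic.RingSolver using (solve-∀)
open import Data.Product using (Σ; _×_; _,_; proj₁; proj₂)
open import Data.Sum using (inj₁; inj₂)
open import Data.Vec as Vec using (Vec; []; _∷_; _∷ʳ_; lookup)
open import Function using (_∘_; id)
open import Function.Bundles using (_⇔_; mk⇔; module Equivalence)
open import Relation.Binary.Definitions using (tri<; tri≈; tri>)
open import Relation.Binary.PropositionalEquality
open import Relation.Nullary using (¬_; Dec; yes; no; contradiction)
open import Relation.Nullary.Decidable using (⌊_⌋; isYes≗does; does-⇔; dec-true; dec-false)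

-- Congruences modulo `p` and divisibility tests.

⌊⌋-⇔ : ∀ {P Q : Set} (P? : Dec P) (Q? : Dec Q) → P ⇔ Q → ⌊ P? ⌋ ≡ ⌊ Q? ⌋
⌊⌋-⇔ P? Q? e = trans (isYes≗does P?) (trans (does-⇔ e P? Q?) (sym (isYes≗does Q?)))

⌊⌋-true : ∀ {P : Set} (P? : Dec P) → P → ⌊ P? ⌋ ≡ true
⌊⌋-true P? p = trans (isYes≗does P?) (dec-true P? p)

⌊⌋-false : ∀ {P : Set} (P? : Dec P) → ¬ P → ⌊ P? ⌋ ≡ false
⌊⌋-false P? ¬p = trans (isYes≗does P?) (dec-false P? ¬p)

b2n≤1 : ∀ b → b2n b ≤ 1
b2n≤1 true  = ≤-refl
b2n≤1 false = z≤n

module _ {p : ℕ} .{{_ : NonZero p}} where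

  +-cong-% : ∀ {a a′ b b′} → a % p ≡ a′ % p → b % p ≡ b′ % p → (a + b) % p ≡ (a′ + b′) % p
  +-cong-% {a} {a′} {b} {b′} e f = begin
    (a + b) % p            ≡⟨ %-distribˡ-+ a b p ⟩
    (a % p + b % p) % p    ≡⟨ cong₂ (λ u v → (u + v) % p) e f ⟩
    (a′ % p + b′ % p) % p  ≡⟨ %-distribˡ-+ a′ b′ p ⟨
    (a′ + b′) % p          ∎
    where open ≡-Reasoning

  *-cong-% : ∀ {a a′ b b′} → a % p ≡ a′ % p → b % p ≡ b′ % p → (a * b) % p ≡ (a′ * b′) % p
  *-cong-% {a} {a′} {b} {b′} e f = begin
    (a * b) % p                ≡⟨ %-distribˡ-* a b p ⟩
    ((a % p) * (b % p)) % p    ≡⟨ cong₂ (λ u v → (u * v) % p) e f ⟩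
    ((a′ % p) * (b′ % p)) % p  ≡⟨ %-distribˡ-* a′ b′ p ⟨
    (a′ * b′) % p              ∎
    where open ≡-Reasoning

  ∣-cong-% : ∀ {a b} → a % p ≡ b % p → p ∣ a → p ∣ b
  ∣-cong-% {a} {b} e d = m%n≡0⇒n∣m b p (trans (sym e) (n∣m⇒m%n≡0 a p d))

  ∣?-cong-% : ∀ {a b} → a % p ≡ b % p → ⌊ p ∣? a ⌋ ≡ ⌊ p ∣? b ⌋
  ∣?-cong-% {a} {b} e = ⌊⌋-⇔ (p ∣? a) (p ∣? b) (mk⇔ (∣-cong-% e) (∣-cong-% (sym e)))

  private
    ∣∸ : ∀ {a b} → a ≤ b → a % p ≡ b % p → p ∣ b ∸ a
    ∣∸ {a} {b} a≤b e = divides (b / p ∸ a / p) (begin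
      b ∸ a ≡⟨ cong₂ _∸_ (m≡m%n+[m/n]*n b p) (m≡m%n+[m/n]*n a p) ⟩
      (b % p + b / p * p) ∸ (a % p + a / p * p) ≡⟨ cong (λ u → (b % p + b / p * p) ∸ (u + a / p * p)) e ⟩
      (b % p + b / p * p) ∸ (b % p + a / p * p) ≡⟨ [m+n]∸[m+o]≡n∸o (b % p) _ _ ⟩
      b / p * p ∸ a / p * p ≡⟨ *-distribʳ-∸ p (b / p) (a / p) ⟨
      (b / p ∸ a / p) * p ∎)
      where open ≡-Reasoning

    ∣∸⇒ : ∀ {a b} → a ≤ b → p ∣ b ∸ a → a % p ≡ b % p
    ∣∸⇒ {a} {b} a≤b (divides k e) = begin
      a % p             ≡⟨ [m+kn]%n≡m%n a k p ⟨
      (a + k * p) % p   ≡⟨ cong (λ u → (a + u) % p) e ⟨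
      (a + (b ∸ a)) % p ≡⟨ cong (_% p) (m+[n∸m]≡n a≤b) ⟩
      b % p             ∎
      where open ≡-Reasoning

  %≡⇒∣∣-∣ : ∀ {a b} → a % p ≡ b % p → p ∣ ∣ a - b ∣
  %≡⇒∣∣-∣ {a} {b} e with ≤-total a b
  ... | inj₁ a≤b = subst (p ∣_) (sym (m≤n⇒∣m-n∣≡n∸m a≤b)) (∣∸ a≤b e)
  ... | inj₂ b≤a = subst (p ∣_) (sym (m≤n⇒∣n-m∣≡n∸m b≤a)) (∣∸ b≤a (sym e))

  ∣∣-∣⇒%≡ : ∀ {a b} → p ∣ ∣ a - b ∣ → a % p ≡ b % p
  ∣∣-∣⇒%≡ {a} {b} d with ≤-total a b
  ... | inj₁ a≤b = ∣∸⇒ a≤b (subst (p ∣_) (m≤n⇒∣m-n∣≡n∸m a≤b) d)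
  ... | inj₂ b≤a = sym (∣∸⇒ b≤a (subst (p ∣_) (m≤n⇒∣n-m∣≡n∸m b≤a) d))

  ∣?-∣-∣-cong : ∀ {a b} t → a % p ≡ b % p → ⌊ p ∣? ∣ a - t ∣ ⌋ ≡ ⌊ p ∣? ∣ b - t ∣ ⌋
  ∣?-∣-∣-cong {a} {b} t e = ⌊⌋-⇔ (p ∣? ∣ a - t ∣) (p ∣? ∣ b - t ∣) (mk⇔
    (λ d → %≡⇒∣∣-∣ {b} {t} (trans (sym e) (∣∣-∣⇒%≡ {a} {t} d)))
    (λ d → %≡⇒∣∣-∣ {a} {t} (trans e (∣∣-∣⇒%≡ {b} {t} d))))

-- Finite sums and zeros of linear forms modulo `p`.

Σ< : ℕ → (ℕ → ℕ) → ℕ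
Σ< zero    f = 0
Σ< (suc n) f = f n + Σ< n f

Σ<-cong : ∀ n {f g : ℕ → ℕ} → (∀ i → i < n → f i ≡ g i) → Σ< n f ≡ Σ< n g
Σ<-cong zero    e = refl
Σ<-cong (suc n) e = cong₂ _+_ (e n ≤-refl) (Σ<-cong n λ i i<n → e i (m≤n⇒m≤1+n i<n))

Σ<-const : ∀ n c → Σ< n (λ _ → c) ≡ n * c
Σ<-const zero    c = refl
Σ<-const (suc n) c = cong (c +_) (Σ<-const n c)

Σ<-distrib-+ : ∀ n f g → Σ< n (λ i → f i + g i) ≡ Σ< n f + Σ< n g
Σ<-distrib-+ zero    f g = refl
Σ<-distrib-+ (suc n) f g rewrite Σ<-distrib-+ n f g = interchange (f n) (g n) (Σ< n f) (Σ< n g)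
  where
  interchange : ∀ a b c d → a + b + (c + d) ≡ a + c + (b + d)
  interchange = solve-∀

Σ<-swap : ∀ n k (f : ℕ → ℕ → ℕ) → Σ< n (λ i → Σ< k (f i)) ≡ Σ< k (λ j → Σ< n λ i → f i j)
Σ<-swap zero    k f = sym (trans (Σ<-const k 0) (*-zeroʳ k))
Σ<-swap (suc n) k f = trans (cong (Σ< k (f n) +_) (Σ<-swap n k f))
                            (sym (Σ<-distrib-+ k (f n) λ j → Σ< n λ i → f i j))

Σ<-shift : ∀ n f → Σ< n (f ∘ suc) + f 0 ≡ f n + Σ< n f
Σ<-shift zero    f = sym (+-identityʳ (f 0))
Σ<-shift (suc n) f = trans (+-assoc (f (suc n)) _ _) (cong (f (suc n) +_) (Σ<-shift n f))

none : List Bool → Bool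
none []       = true
none (z ∷ zs) = not z ∧ none zs

module _ (p : ℕ) .{{_ : NonZero p}} where

  private
    hit : ℕ → ℕ
    hit a = b2n ⌊ p ∣? a ⌋

    hit-cong : ∀ {a b} → a % p ≡ b % p → hit a ≡ hit b
    hit-cong e = cong b2n (∣?-cong-% {p} e)

  -- Raising `c` by one drops `c` from the window and admits `c + p`, which has the same residue.
  -- The window starting at 0 contains only the multiple 0.
  one-multiple-in-window : ∀ c → Σ< p (λ v → b2n ⌊ p ∣? (c + v) ⌋) ≡ 1
  one-multiple-in-window zero = go p refl
    where
    below : ∀ n → n < p → Σ< n (λ v → hit (suc v)) ≡ 0
    below zero    _ = refl
    below (suc n) lt = cong₂ _+_ (cong b2n (⌊⌋-false (p ∣? suc n) λ d → <⇒≱ lt (∣⇒≤ d)))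
                                  (below n (<-trans ≤-refl lt))
    go : ∀ n → n ≡ p → Σ< n hit ≡ 1
    go zero e = ⊥-elim (≢-nonZero⁻¹ p (sym e))
    go (suc n) e = trans (sym (Σ<-shift n hit))
      (cong₂ _+_ (below n (≤-reflexive e)) (cong b2n (⌊⌋-true (p ∣? 0) (p ∣0))))
  one-multiple-in-window (suc c) = trans (+-cancelʳ-≡ (hit c) _ _ shifted) (one-multiple-in-window c)
    where
    open ≡-Reasoning
    F : ℕ → ℕ
    F v = hit (c + v)
    shifted : Σ< p (λ v → hit (suc c + v)) + hit c ≡ Σ< p F + hit c
    shifted = begin
      Σ< p (λ v → hit (suc c + v)) + hit c ≡⟨ cong₂ _+_ (Σ<-cong p λ v _ → cong hit (sym (+-suc c v))) (cong hit (sym (+-identityʳ c))) ⟩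
      Σ< p (F ∘ suc) + F 0                 ≡⟨ Σ<-shift p F ⟩
      F p + Σ< p F                         ≡⟨ cong (_+ Σ< p F) (hit-cong ([m+n]%n≡m%n c p)) ⟩
      hit c + Σ< p F                       ≡⟨ +-comm (hit c) _ ⟩
      Σ< p F + hit c                       ∎

  -- The number of v ∈ {0,…,p−1}ᵏ for which p divides c + v·z.
  zeros : List Bool → ℕ → ℕ
  zeros []       c = b2n ⌊ p ∣? c ⌋
  zeros (z ∷ zs) c = Σ< p λ v → zeros zs (c + v * b2n z)

  -- For each fixed vector the shift alone sweeps a window of `p` consecutive numbers, so every
  -- vector contributes exactly 1.
  Σ<-zeros : ∀ zs c → Σ< p (λ v → zeros zs (c + v)) ≡ p ^ length zs
  Σ<-zeros [] c = one-multiple-in-window c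
  Σ<-zeros (z ∷ zs) c = begin
    Σ< p (λ v → Σ< p λ w → zeros zs (c + v + w * b2n z)) ≡⟨ Σ<-swap p p _ ⟩
    Σ< p (λ w → Σ< p λ v → zeros zs (c + v + w * b2n z)) ≡⟨ Σ<-cong p (λ w _ → Σ<-cong p λ v _ → cong (zeros zs) (swap c v (w * b2n z))) ⟩
    Σ< p (λ w → Σ< p λ v → zeros zs (c + w * b2n z + v)) ≡⟨ Σ<-cong p (λ w _ → Σ<-zeros zs (c + w * b2n z)) ⟩
    Σ< p (λ _ → p ^ length zs)                           ≡⟨ Σ<-const p _ ⟩
    p * p ^ length zs                                    ∎
    where
    open ≡-Reasoning
    swap : ∀ a b d → a + b + d ≡ a + d + b
    swap = solve-∀

  zeros-none : ∀ zs → none zs ≡ true → zeros zs 0 ≡ p ^ length zs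
  zeros-none []           _ = cong b2n (⌊⌋-true (p ∣? 0) (p ∣0))
  zeros-none (false ∷ zs) e = trans (Σ<-cong p λ v _ → trans (cong (zeros zs) (*-zeroʳ v)) (zeros-none zs e)) (Σ<-const p _)

  -- The coordinate paired with the first set bit acts as a free shift, so a proportion 1/p of all
  -- vectors are zeros, whatever the other bits are. The factor `p` on the left avoids a division.
  zeros-some : ∀ zs c → none zs ≡ false → p * zeros zs c ≡ p ^ length zs
  zeros-some (true ∷ zs)  c e = cong (p *_) (trans (Σ<-cong p λ v _ → cong (λ u → zeros zs (c + u)) (*-identityʳ v)) (Σ<-zeros zs c))
  zeros-some (false ∷ zs) c e = cong (p *_) (begin
    Σ< p (λ v → zeros zs (c + v * 0)) ≡⟨ Σ<-cong p (λ v _ → cong (zeros zs) (trans (cong (c +_) (*-zeroʳ v)) (+-identityʳ c))) ⟩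
    Σ< p (λ v → zeros zs c)           ≡⟨ Σ<-const p _ ⟩
    p * zeros zs c                    ≡⟨ zeros-some zs c e ⟩
    p ^ length zs                     ∎)
    where open ≡-Reasoning

prime∣^⇒∣ : ∀ {q} → Prime q → ∀ a k → q ∣ a ^ k → q ∣ a
prime∣^⇒∣ pq a zero d = ⊥-elim (<⇒≢ (nonTrivial⇒n>1 _ {{prime⇒nonTrivial pq}}) (sym (∣1⇒≡1 d)))
prime∣^⇒∣ pq a (suc k) d with euclidsLemma a (a ^ k) pq d
... | inj₁ h = h
... | inj₂ h = prime∣^⇒∣ pq a k h

prime∣prime⇒≡ : ∀ {p q} → Prime p → Prime q → p ∣ q → p ≡ q
prime∣prime⇒≡ pp pq d with prime⇒irreducible pq d
... | inj₁ e = ⊥-elim (<⇒≢ (nonTrivial⇒n>1 _ {{prime⇒nonTrivial pp}}) (sym e))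
... | inj₂ e = e

-- When some bit is set, p zeros = pᵏ, so modulo q the sum tested here is pᵏ⁻¹ − pᵏ = −pᵏ⁻¹(p − 1),
-- which p < q keeps away from 0.
none-zeros : ∀ {p q} (pp : Prime p) (pq : Prime q) → p < q → ∀ zs →
  none zs ≡ ⌊ q ∣? (zeros p {{prime⇒nonZero pp}} zs 0 + pred q * p ^ length zs) ⌋
none-zeros {p} {q} pp pq p<q zs with none zs in e
... | true = sym (⌊⌋-true (q ∣? _) (subst (q ∣_) (sym eq) (m∣m*n _)))
  where
  instance _ = prime⇒nonZero pp
  instance _ = prime⇒nonZero pq
  eq : zeros p zs 0 + pred q * p ^ length zs ≡ q * p ^ length zs
  eq = trans (cong (_+ pred q * p ^ length zs) (zeros-none p zs e)) (cong (_* p ^ length zs) (suc-pred q))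
... | false = sym (⌊⌋-false (q ∣? _) ¬div)
  where
  instance _ = prime⇒nonZero pp
  instance _ = prime⇒nonZero pq
  z = zeros p zs 0
  rearrange : ∀ z p′ q′ → (z + q′ * (z + p′ * z)) + p′ * z ≡ suc q′ * (z + p′ * z)
  rearrange = solve-∀
  pz : z + pred p * z ≡ p ^ length zs
  pz = trans (cong (_* z) (suc-pred p)) (zeros-some p zs 0 e)
  ¬q∣p : ¬ (q ∣ p)
  ¬q∣p d = <⇒≱ p<q (∣⇒≤ d)
  ¬q∣p-1 : ¬ (q ∣ pred p)
  ¬q∣p-1 d = <⇒≱ p<q (≤-trans (∣⇒≤ {{>-nonZero p-1>0}} d) pred[n]≤n)
    where
    p-1>0 : 0 < pred p
    p-1>0 = s<s⁻¹ (subst (1 <_) (sym (suc-pred p)) (nonTrivial⇒n>1 p {{prime⇒nonTrivial pp}}))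
  ¬div : ¬ (q ∣ z + pred q * p ^ length zs)
  ¬div d with euclidsLemma (pred p) z pq
    (∣m+n∣m⇒∣n (subst (q ∣_) (sym total) (m∣m*n _)) d)
    where
    total : (z + pred q * p ^ length zs) + pred p * z ≡ q * p ^ length zs
    total = subst₂ (λ u w → (z + pred q * u) + pred p * z ≡ w * u) pz (suc-pred q) (rearrange z (pred p) (pred q))
  ... | inj₁ h = ¬q∣p-1 h
  ... | inj₂ h = ¬q∣p (prime∣^⇒∣ pq p (length zs) (subst (q ∣_) (zeros-some p zs 0 e) (∣n⇒∣m*n p h)))

-- Coprime moduli and their products.

coprime-*ʳ : ∀ {a b c} → Coprime a b → Coprime a c → Coprime a (b * c)
coprime-*ʳ ab ac (d∣a , d∣bc) = ac (d∣a , coprime-divisor (λ { (x , y) → ab (∣-trans x d∣a , y) }) d∣bc)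

coprime-^ : ∀ {a b} → Coprime a b → ∀ e f → Coprime (a ^ e) (b ^ f)
coprime-^ {a} {b} ab e f = Coprimality.sym (pow (Coprimality.sym (pow ab f)) e)
  where
  pow : ∀ {x y} → Coprime x y → ∀ k → Coprime x (y ^ k)
  pow xy zero    = Coprimality.sym (Coprimality.1-coprimeTo _)
  pow xy (suc k) = coprime-*ʳ xy (pow xy k)

∤⇒coprime : ∀ {p a} → Prime p → ¬ (p ∣ a) → Coprime p a
∤⇒coprime pp p∤a (d∣p , d∣a) with prime⇒irreducible pp d∣p
... | inj₁ d≡1 = d≡1
... | inj₂ refl = ⊥-elim (p∤a d∣a)

coprime-*∣ : ∀ {a b n} → Coprime a b → a ∣ n → b ∣ n → a * b ∣ n
coprime-*∣ {a} {b} ab (divides k refl) b∣n =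
  subst (_∣ k * a) (*-comm b a)
    (*-monoˡ-∣ a (coprime-divisor {o = k} (Coprimality.sym ab) (subst (b ∣_) (*-comm k a) b∣n)))

product∣ : ∀ {ds n} → AllPairs Coprime ds → All (_∣ n) ds → product ds ∣ n
product∣ [] [] = 1∣ _
product∣ (c ∷ cs) (d ∷ ds) = coprime-*∣ (coprime-product c) d (product∣ cs ds)
  where
  coprime-product : ∀ {a bs} → All (Coprime a) bs → Coprime a (product bs)
  coprime-product []       = Coprimality.sym (Coprimality.1-coprimeTo _)
  coprime-product (x ∷ xs) = coprime-*ʳ x (coprime-product xs)

-- Binomial coefficients modulo a prime.

nC0≡1 : ∀ n → n choose 0 ≡ 1
nC0≡1 n = trans (nCk≡nC[n∸k] {0} {n} z≤n) (nCn≡1 n)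

[k+1]*[n+1]C[k+1]≡[n+1]*nCk : ∀ n k → suc k * (suc n choose suc k) ≡ suc n * (n choose k)
[k+1]*[n+1]C[k+1]≡[n+1]*nCk n zero = trans (*-identityˡ (suc n choose 1)) (trans (nC1≡n (suc n))
  (sym (trans (cong (suc n *_) (nC0≡1 n)) (*-identityʳ (suc n)))))
[k+1]*[n+1]C[k+1]≡[n+1]*nCk zero (suc k) =
  trans (cong (suc (suc k) *_) (k>n⇒nCk≡0 {1} {suc (suc k)} (s≤s (s≤s z≤n))))
        (trans (*-zeroʳ (suc (suc k))) (cong (1 *_) (sym (k>n⇒nCk≡0 {0} {suc k} (s≤s z≤n)))))
[k+1]*[n+1]C[k+1]≡[n+1]*nCk (suc n) (suc k) = begin
  suc (suc k) * (suc (suc n) choose suc (suc k))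
    ≡⟨ cong (suc (suc k) *_) (nCk+nC[k+1]≡[n+1]C[k+1] (suc n) (suc k)) ⟨
  suc (suc k) * (suc n choose suc k + suc n choose suc (suc k))
    ≡⟨ split (suc k) (suc n choose suc k) (suc n choose suc (suc k)) ⟩
  suc k * (suc n choose suc k) + suc (suc k) * (suc n choose suc (suc k)) + suc n choose suc k
    ≡⟨ cong (_+ suc n choose suc k) (cong₂ _+_ ([k+1]*[n+1]C[k+1]≡[n+1]*nCk n k) ([k+1]*[n+1]C[k+1]≡[n+1]*nCk n (suc k))) ⟩
  suc n * (n choose k) + suc n * (n choose suc k) + suc n choose suc k
    ≡⟨ cong (_+ suc n choose suc k) (trans (sym (*-distribˡ-+ (suc n) (n choose k) (n choose suc k)))
                    (cong (suc n *_) (nCk+nC[k+1]≡[n+1]C[k+1] n k))) ⟩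
  suc n * (suc n choose suc k) + suc n choose suc k
    ≡⟨ +-comm (suc n * (suc n choose suc k)) (suc n choose suc k) ⟩
  suc (suc n) * (suc n choose suc k) ∎
  where
  open ≡-Reasoning
  split : ∀ k a b → suc k * (a + b) ≡ k * a + suc k * b + a
  split = solve-∀

module _ {p : ℕ} (pp : Prime p) where

  private instance _ = prime⇒nonZero pp

  -- By absorption p^e divides (k + 1) C(p^e, k + 1). If `p` did not divide the binomial, p^e would
  -- divide k + 1, which is smaller.
  prime∣[p^e]Ck : ∀ e k → suc k < p ^ e → p ∣ (p ^ e) choose suc k
  prime∣[p^e]Ck e k lt with p ∣? (p ^ e) choose suc k
  ... | yes d = d
  ... | no ¬d = contradiction (∣⇒≤ (coprime-divisor {o = suc k} cop div)) (<⇒≱ lt)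
    where
    cop : Coprime (p ^ e) ((p ^ e) choose suc k)
    cop = subst (Coprime (p ^ e)) (*-identityʳ _) (coprime-^ (∤⇒coprime pp ¬d) e 1)
    absorb : ∀ N → N ≡ p ^ e → .{{NonZero N}} → N ∣ (N choose suc k) * suc k
    absorb (suc n) _ = subst (suc n ∣_) (trans (sym ([k+1]*[n+1]C[k+1]≡[n+1]*nCk n k)) (*-comm (suc k) _)) (m∣m*n _)
    div : p ^ e ∣ ((p ^ e) choose suc k) * suc k
    div = absorb (p ^ e) refl {{m^n≢0 p e}}

  -- Induction on `s` with Pascal's rule does the work of the Vandermonde convolution. The case s =
  -- 0 is the divisibility of C(p^e, i) for 0 < i < p^e.
  C-periodic-step : ∀ e s i → i < p ^ e → ((p ^ e + s) choose i) % p ≡ (s choose i) % p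
  C-periodic-step e s zero lt = cong (_% p) (trans (nC0≡1 (p ^ e + s)) (sym (nC0≡1 s)))
  C-periodic-step e zero (suc i) lt = begin
    ((p ^ e + 0) choose suc i) % p ≡⟨ cong (λ u → (u choose suc i) % p) (+-identityʳ (p ^ e)) ⟩
    ((p ^ e) choose suc i) % p     ≡⟨ n∣m⇒m%n≡0 _ p (prime∣[p^e]Ck e i lt) ⟩
    0                         ≡⟨ m<n⇒m%n≡m (>-nonZero⁻¹ p) ⟨
    0 % p                     ≡⟨ cong (_% p) (k>n⇒nCk≡0 {0} {suc i} z<s) ⟨
    (0 choose suc i) % p           ∎
    where
    open ≡-Reasoning
  C-periodic-step e (suc s) (suc i) lt = begin
    ((p ^ e + suc s) choose suc i) % p                   ≡⟨ cong (λ u → (u choose suc i) % p) (+-suc (p ^ e) s) ⟩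
    (suc (p ^ e + s) choose suc i) % p                   ≡⟨ cong (_% p) (nCk+nC[k+1]≡[n+1]C[k+1] (p ^ e + s) i) ⟨
    ((p ^ e + s) choose i + (p ^ e + s) choose suc i) % p
      ≡⟨ +-cong-% {p} {(p ^ e + s) choose i} {s choose i}
          (C-periodic-step e s i (<-trans ≤-refl lt)) (C-periodic-step e s (suc i) lt) ⟩
    (s choose i + s choose suc i) % p                         ≡⟨ cong (_% p) (nCk+nC[k+1]≡[n+1]C[k+1] s i) ⟩
    (suc s choose suc i) % p                             ∎
    where open ≡-Reasoning

  C-periodic : ∀ e s i → i < p ^ e → (s choose i) % p ≡ ((_%_ s (p ^ e) {{m^n≢0 p e}}) choose i) % p
  C-periodic e s i lt = trans (cong (λ u → (u choose i) % p) (trans (m≡m%n+[m/n]*n s (p ^ e)) (+-comm (s % p ^ e) _))) (go (s / p ^ e))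
    where
    instance _ = m^n≢0 p e
    go : ∀ t → ((t * p ^ e + s % p ^ e) choose i) % p ≡ ((s % p ^ e) choose i) % p
    go zero = refl
    go (suc t) = trans (cong (λ u → (u choose i) % p) (+-assoc (p ^ e) (t * p ^ e) _))
                       (trans (C-periodic-step e (t * p ^ e + s % p ^ e) i lt) (go t))

-- Newton interpolation modulo `p`.

module _ (p : ℕ) .{{_ : NonZero p}} where

  -- The forward difference, with `pred p` in the role of -1. Reduction modulo `p` keeps iterated
  -- differences below `p`; they later become wire multiplicities.
  Δ : (ℕ → ℕ) → ℕ → ℕ
  Δ g s = (g (suc s) + pred p * g s) % p

  g+Δg : ∀ g s → (g s + Δ g s) % p ≡ g (suc s) % p
  g+Δg g s = begin
    (g s + Δ g s) % p                      ≡⟨ +-cong-% {p} {g s} refl (m%n%n≡m%n (g (suc s) + pred p * g s) p) ⟩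
    (g s + (g (suc s) + pred p * g s)) % p ≡⟨ cong (_% p) (rearrange (g s) (g (suc s)) (pred p)) ⟩
    (g (suc s) + suc (pred p) * g s) % p   ≡⟨ cong (λ u → (g (suc s) + u) % p) (trans (cong (_* g s) (suc-pred p)) (*-comm p (g s))) ⟩
    (g (suc s) + g s * p) % p              ≡⟨ [m+kn]%n≡m%n (g (suc s)) (g s) p ⟩
    g (suc s) % p                          ∎
    where
    open ≡-Reasoning
    rearrange : ∀ a b q → a + (b + q * a) ≡ b + suc q * a
    rearrange = solve-∀

  -- N terms, from degree i on, of Newton's forward difference expansion of g.
  newton : ℕ → ℕ → (ℕ → ℕ) → ℕ → ℕ
  newton zero    i g s = 0
  newton (suc N) i g s = g 0 * (s choose i) + newton N (suc i) (Δ g) s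

  newton-pascal : ∀ N i g s → newton N (suc i) g (suc s) ≡ newton N i g s + newton N (suc i) g s
  newton-pascal zero    i g s = refl
  newton-pascal (suc N) i g s
    rewrite newton-pascal N (suc i) (Δ g) s | sym (nCk+nC[k+1]≡[n+1]C[k+1] s i)
    = rearrange (g 0) (s choose i) (s choose suc i) (newton N (suc i) (Δ g) s) (newton N (suc (suc i)) (Δ g) s)
    where
    rearrange : ∀ a b c d e → a * (b + c) + (d + e) ≡ a * b + d + (a * c + e)
    rearrange = solve-∀

  newton-at-0 : ∀ N i g → newton N (suc i) g 0 ≡ 0
  newton-at-0 zero    i g = refl
  newton-at-0 (suc N) i g = cong₂ _+_ (trans (cong (g 0 *_) (k>n⇒nCk≡0 {0} {suc i} z<s)) (*-zeroʳ (g 0)))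
                                      (newton-at-0 N (suc i) (Δ g))

  -- By Pascal's rule the expansion of `g` at s + 1 is that of `g` plus that of `Δ g`, both at `s`.
  -- By induction these are g s and Δ g s, which add up to g (s + 1) modulo `p`.
  newton-interpolates : ∀ N g s → s < N → newton N 0 g s % p ≡ g s % p
  newton-interpolates (suc N) g zero _ = cong (_% p)
    (trans (cong₂ _+_ (*-identityʳ (g 0)) (newton-at-0 N 0 (Δ g))) (+-identityʳ (g 0)))
  newton-interpolates (suc N) g (suc s) (s≤s lt) = begin
    newton (suc N) 0 g (suc s) % p
      ≡⟨ cong (_% p) (cong₂ _+_ (cong (g 0 *_) (trans (nC0≡1 (suc s)) (sym (nC0≡1 s)))) (newton-pascal N 0 (Δ g) s)) ⟩
    (g 0 * (s choose 0) + (newton N 0 (Δ g) s + newton N 1 (Δ g) s)) % p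
      ≡⟨ cong (_% p) (rearrange (g 0 * (s choose 0)) (newton N 0 (Δ g) s) _) ⟩
    (newton (suc N) 0 g s + newton N 0 (Δ g) s) % p
      ≡⟨ +-cong-% {p} {newton (suc N) 0 g s} {g s} (newton-interpolates (suc N) g s (m≤n⇒m≤1+n lt)) (newton-interpolates N (Δ g) s lt) ⟩
    (g s + Δ g s) % p
      ≡⟨ g+Δg g s ⟩
    g (suc s) % p ∎
    where
    open ≡-Reasoning
    rearrange : ∀ a b c → a + (b + c) ≡ a + c + b
    rearrange = solve-∀

-- The expansion with p^e terms involves only binomials of degree below p^e, all of period p^e
-- modulo `p`. Hence `s` may be replaced by its remainder, where the interpolation is valid.
newton-periodic : ∀ {p} (pp : Prime p) e g s →
  let instance _ = prime⇒nonZero pp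
      instance _ = m^n≢0 p e
  in newton p (p ^ e) 0 g s % p ≡ g (s % p ^ e) % p
newton-periodic {p} pp e g s = trans (go (p ^ e) 0 g ≤-refl)
    (newton-interpolates p (p ^ e) g (s % p ^ e) (m%n<n s (p ^ e)))
  where
  instance _ = prime⇒nonZero pp
  instance _ = m^n≢0 p e
  go : ∀ N i g → i + N ≤ p ^ e → newton p N i g s % p ≡ newton p N i g (s % p ^ e) % p
  go zero    i g _  = refl
  go (suc N) i g le = +-cong-% {p} {g 0 * (s choose i)} {g 0 * ((s % p ^ e) choose i)}
    (*-cong-% {p} {g 0} {g 0} {s choose i} {(s % p ^ e) choose i} refl (C-periodic pp e s i (≤-trans (m<m+n i z<s) le)))
    (go N (suc i) (Δ p g) (≤-trans (≤-reflexive (sym (+-suc i N))) le))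

-- Formulas of MOD gates and their compilation to circuits.

lookup-∷ʳ-inject₁ : ∀ {A : Set} {k} (v : Vec A k) a i → lookup (v ∷ʳ a) (inject₁ i) ≡ lookup v i
lookup-∷ʳ-inject₁ (b ∷ v) a Fin.zero    = refl
lookup-∷ʳ-inject₁ (b ∷ v) a (Fin.suc i) = lookup-∷ʳ-inject₁ v a i

lookup-∷ʳ-fromℕ : ∀ {A : Set} {k} (v : Vec A k) a → lookup (v ∷ʳ a) (fromℕ k) ≡ a
lookup-∷ʳ-fromℕ []      a = refl
lookup-∷ʳ-fromℕ (b ∷ v) a = lookup-∷ʳ-fromℕ v a

foldr-⊔-∷ʳ : ∀ {k D} (v : Vec ℕ k) a → Vec.foldr _ _⊔_ 0 v ≤ D → a ≤ D → Vec.foldr _ _⊔_ 0 (v ∷ʳ a) ≤ D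
foldr-⊔-∷ʳ []      a h h′ = ⊔-lub h′ z≤n
foldr-⊔-∷ʳ (b ∷ v) a h h′ = ⊔-lub (m⊔n≤o⇒m≤o b _ h) (foldr-⊔-∷ʳ v a (m⊔n≤o⇒n≤o b _ h) h′)

module Formulas (m W n : ℕ) where

  private X = Vec Bool n

  -- Computed d f: f is computed by a formula of MOD_m gates of fan-in at most W and depth at most d.
  -- Summed d N s: s is the sum of at most N such functions.
  mutual
    data Computed : ℕ → (X → Bool) → Set where
      input : ∀ {d f} (i : Fin n) → (∀ x → f x ≡ lookup x i) → Computed d f
      const : ∀ {d f} (b : Bool) → (∀ x → f x ≡ b) → Computed d f
      gate  : ∀ {d N s f} → Summed d N s → N ≤ W → (∀ x → f x ≡ ⌊ m ∣? s x ⌋) → Computed (suc d) f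

    data Summed : ℕ → ℕ → (X → ℕ) → Set where
      empty : ∀ {d N s} → (∀ x → s x ≡ 0) → Summed d N s
      cons  : ∀ {d N f s t} → Computed d f → Summed d N s → (∀ x → t x ≡ b2n (f x) + s x) → Summed d (suc N) t

  -- Wires are typed by the number of gates, so appending gates changes their type. `lift` carries
  -- wires to earlier results into the grown circuit.
  record _⊑_ {k l} (Γ : Circuit n k) (Γ′ : Circuit n l) : Set where
    field
      lift       : Wire n k → Wire n l
      lift-val   : ∀ x w → wireVal x (gateValues m Γ′ x) (lift w) ≡ wireVal x (gateValues m Γ x) w
      lift-depth : ∀ w → wireDepth (gateDepths Γ′) (lift w) ≡ wireDepth (gateDepths Γ) w
  open _⊑_

  ⊑-refl : ∀ {k} {Γ : Circuit n k} → Γ ⊑ Γ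
  ⊑-refl = record { lift = id ; lift-val = λ _ _ → refl ; lift-depth = λ _ → refl }

  ⊑-trans : ∀ {k l o} {Γ : Circuit n k} {Γ′ : Circuit n l} {Γ″ : Circuit n o} → Γ ⊑ Γ′ → Γ′ ⊑ Γ″ → Γ ⊑ Γ″
  ⊑-trans e e′ = record
    { lift       = lift e′ ∘ lift e
    ; lift-val   = λ x w → trans (lift-val e′ x (lift e w)) (lift-val e x w)
    ; lift-depth = λ w → trans (lift-depth e′ (lift e w)) (lift-depth e w)
    }

  ⊑-▷ : ∀ {k} {Γ : Circuit n k} g → Γ ⊑ (Γ ▷ g)
  ⊑-▷ {Γ = Γ} g = record
    { lift       = λ { (var i) → var i ; (const b) → const b ; (gate j) → gate (inject₁ j) }
    ; lift-val   = λ x → λ { (var i) → refl ; (const b) → refl ; (gate j) → cong b2n (lookup-∷ʳ-inject₁ (gateValues m Γ x) _ j) }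
    ; lift-depth = λ { (var i) → refl ; (const b) → refl ; (gate j) → lookup-∷ʳ-inject₁ (gateDepths Γ) _ j }
    }

  gateValue : ∀ {k} → Circuit n k → Gate n k → X → ℕ
  gateValue Γ g x = sum (List.map (wireVal x (gateValues m Γ x)) g)

  gateDepth : ∀ {k} → Circuit n k → Gate n k → ℕ
  gateDepth Γ g = maxL (List.map (wireDepth (gateDepths Γ)) g)

  lift-gateValue : ∀ {k l} {Γ : Circuit n k} {Γ′ : Circuit n l} (e : Γ ⊑ Γ′) g x →
    gateValue Γ′ (List.map (lift e) g) x ≡ gateValue Γ g x
  lift-gateValue e g x = cong sum (trans (sym (map-∘ g)) (map-cong (lift-val e x) g))

  lift-gateDepth : ∀ {k l} {Γ : Circuit n k} {Γ′ : Circuit n l} (e : Γ ⊑ Γ′) g →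
    gateDepth Γ′ (List.map (lift e) g) ≡ gateDepth Γ g
  lift-gateDepth e g = cong maxL (trans (sym (map-∘ g)) (map-cong (lift-depth e) g))

  record Extension {k} (Γ : Circuit n k) (D size : ℕ) : Set where
    field
      {gates} : ℕ
      circuit : Circuit n gates
      extends : Γ ⊑ circuit
      small   : gates ≤ k + size
      shallow : depth circuit ≤ D
  open Extension

  mutual
    -- Every subformula gets fresh gates, and a gate over at most `W` subformulas costs at most 1 +
    -- W (1 + W)^d ≤ (1 + W)^(d + 1). `D` bounds the depth of the whole circuit so far, `d` that of
    -- the output wire alone.
    compile : ∀ {k D d f} (Γ : Circuit n k) → depth Γ ≤ D → d ≤ D → Computed d f →
      Σ (Extension Γ D (suc W ^ d)) λ E → Σ (Wire n (gates E)) λ w →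
        (∀ x → wireVal x (gateValues m (circuit E) x) w ≡ b2n (f x)) × wireDepth (gateDepths (circuit E)) w ≤ d
    compile {k} Γ hC d≤D (input i e) =
      record { circuit = Γ ; extends = ⊑-refl ; small = m≤m+n k _ ; shallow = hC } ,
      var i , (λ x → cong b2n (sym (e x))) , z≤n
    compile {k} Γ hC d≤D (const b e) =
      record { circuit = Γ ; extends = ⊑-refl ; small = m≤m+n k _ ; shallow = hC } ,
      const b , (λ x → cong b2n (sym (e x))) , z≤n
    compile {k} {D} Γ hC d≤D (gate {d} {N} {s} S N≤W e)
      with E , g , val , dep ← compileSum {D = D} Γ hC (≤-trans (n≤1+n d) d≤D) S =
      record
        { circuit = circuit E ▷ g
        ; extends = ⊑-trans (extends E) (⊑-▷ g)
        ; small   = size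
        ; shallow = foldr-⊔-∷ʳ (gateDepths (circuit E)) _ (shallow E) (≤-trans (s≤s dep) d≤D)
        } ,
      gate (fromℕ _) ,
      (λ x → cong b2n (trans (lookup-∷ʳ-fromℕ (gateValues m (circuit E) x) _)
                             (trans (cong (λ u → ⌊ m ∣? u ⌋) (val x)) (sym (e x))))) ,
      ≤-trans (≤-reflexive (lookup-∷ʳ-fromℕ (gateDepths (circuit E)) _)) (s≤s dep)
      where
      open ≤-Reasoning
      size : suc (gates E) ≤ k + suc W ^ suc d
      size = begin
        suc (gates E)                      ≤⟨ s≤s (small E) ⟩
        suc (k + N * suc W ^ d)            ≡⟨ +-suc k _ ⟨
        k + (1 + N * suc W ^ d)            ≤⟨ +-monoʳ-≤ k (+-mono-≤ (m^n>0 (suc W) d) (*-monoˡ-≤ (suc W ^ d) N≤W)) ⟩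
        k + (suc W ^ d + W * suc W ^ d)    ∎

    compileSum : ∀ {k D d N s} (Γ : Circuit n k) → depth Γ ≤ D → d ≤ D → Summed d N s →
      Σ (Extension Γ D (N * suc W ^ d)) λ E → Σ (Gate n (gates E)) λ g →
        (∀ x → gateValue (circuit E) g x ≡ s x) × gateDepth (circuit E) g ≤ d
    compileSum {k} Γ hC d≤D (empty e) =
      record { circuit = Γ ; extends = ⊑-refl ; small = m≤m+n k _ ; shallow = hC } ,
      [] , (λ x → sym (e x)) , z≤n
    compileSum {k} {D} {d} Γ hC d≤D (cons {N = N} F S e)
      with E , g , val , dep ← compileSum {D = D} Γ hC d≤D S
      with E′ , w , val′ , dep′ ← compile {D = D} (circuit E) (shallow E) d≤D F =
      record
        { circuit = circuit E′
        ; extends = ⊑-trans (extends E) (extends E′)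
        ; small   = size
        ; shallow = shallow E′
        } ,
      w ∷ List.map (lift (extends E′)) g ,
      (λ x → trans (cong₂ _+_ (val′ x) (trans (lift-gateValue (extends E′) g x) (val x))) (sym (e x))) ,
      ⊔-lub dep′ (≤-trans (≤-reflexive (lift-gateDepth (extends E′) g)) dep)
      where
      open ≤-Reasoning
      size : gates E′ ≤ k + (suc W ^ d + N * suc W ^ d)
      size = begin
        gates E′                                 ≤⟨ small E′ ⟩
        gates E + suc W ^ d                      ≤⟨ +-monoˡ-≤ _ (small E) ⟩
        k + N * suc W ^ d + suc W ^ d            ≡⟨ +-assoc k _ _ ⟩
        k + (N * suc W ^ d + suc W ^ d)          ≡⟨ cong (k +_) (+-comm _ (suc W ^ d)) ⟩
        k + (suc W ^ d + N * suc W ^ d)          ∎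

  -- The output gate is passed unfolded: a `Computed` function may be a bare input or constant,
  -- whereas `evalMod` reads the last gate.
  toCircuit : ∀ {d N s} (f : X → Bool) → Summed d N s → N ≤ W → (∀ x → f x ≡ ⌊ m ∣? s x ⌋) →
    Σ ℕ λ k → Σ (Circuit n (suc k)) λ Γ →
      (∀ x → evalMod m Γ x ≡ f x) × depth Γ ≤ suc d × suc k ≤ suc W ^ suc d
  toCircuit {d} {N} f S N≤W e
    with E , g , val , dep ← compileSum {D = suc d} [] z≤n (n≤1+n d) S =
    gates E , circuit E ▷ g ,
    (λ x → trans (lookup-∷ʳ-fromℕ (gateValues m (circuit E) x) _)
                 (trans (cong (λ u → ⌊ m ∣? u ⌋) (val x)) (sym (e x)))) ,
    foldr-⊔-∷ʳ (gateDepths (circuit E)) _ (shallow E) (s≤s dep) ,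
    ≤-trans (s≤s (small E)) (+-mono-≤ (m^n>0 (suc W) d) (*-monoˡ-≤ (suc W ^ d) N≤W))

  Summed-≤ : ∀ {d N N′ s} → N ≤ N′ → Summed d N s → Summed d N′ s
  Summed-≤ _        (empty e)    = empty e
  Summed-≤ (s≤s le) (cons F S e) = cons F (Summed-≤ le S) e

  Summed-cong : ∀ {d N s t} → (∀ x → t x ≡ s x) → Summed d N s → Summed d N t
  Summed-cong h (empty e)    = empty λ x → trans (h x) (e x)
  Summed-cong h (cons F S e) = cons F S λ x → trans (h x) (e x)

  Summed-+ : ∀ {d N N′ s t} → Summed d N s → Summed d N′ t → Summed d (N + N′) (λ x → s x + t x)
  Summed-+ {N = N} {t = t} (empty e) T = Summed-≤ (m≤n+m _ N) (Summed-cong (λ x → cong (_+ t x) (e x)) T)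
  Summed-+ {t = t} (cons {f = f} {s = s} F S e) T = cons F (Summed-+ S T)
    λ x → trans (cong (_+ t x) (e x)) (+-assoc (b2n (f x)) (s x) (t x))

  Summed-b2n : ∀ {d f} → Computed d f → Summed d 1 (b2n ∘ f)
  Summed-b2n F = cons F (empty {s = λ _ → 0} λ _ → refl) λ x → sym (+-identityʳ _)

  Summed-* : ∀ {d N s} c → Summed d N s → Summed d (c * N) (λ x → c * s x)
  Summed-* zero    S = empty λ _ → refl
  Summed-* (suc c) S = Summed-+ S (Summed-* c S)

  Summed-const : ∀ {d} c → Summed d c (λ _ → c)
  Summed-const c = Summed-≤ (≤-reflexive (*-identityʳ c))
    (Summed-cong (λ _ → sym (*-identityʳ c)) (Summed-* c (Summed-b2n (const true λ _ → refl))))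

  Summed-Σ< : ∀ {d N} k {s : ℕ → X → ℕ} → (∀ i → i < k → Summed d N (s i)) → Summed d (k * N) (λ x → Σ< k λ i → s i x)
  Summed-Σ< zero    S = empty λ _ → refl
  Summed-Σ< (suc k) S = Summed-+ (S k ≤-refl) (Summed-Σ< k λ i i<k → S i (m≤n⇒m≤1+n i<k))

  Computed-cong : ∀ {d f g} → (∀ x → g x ≡ f x) → Computed d f → Computed d g
  Computed-cong h (input i e)    = input i λ x → trans (h x) (e x)
  Computed-cong h (const b e)    = const b λ x → trans (h x) (e x)
  Computed-cong h (gate S le e)  = gate S le λ x → trans (h x) (e x)

-- Conjunctions, residues and interpolation by MOD gates.

count : List Bool → ℕ
count bs = sum (map b2n bs)

none-not : ∀ bs → none (map not bs) ≡ and bs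
none-not []           = refl
none-not (true ∷ bs)  = none-not bs
none-not (false ∷ bs) = refl

Σ<-zero : ∀ n {f} → (∀ i → i < n → f i ≡ 0) → Σ< n f ≡ 0
Σ<-zero n e = trans (Σ<-cong n e) (trans (Σ<-const n 0) (*-zeroʳ n))

Σ<-single : ∀ n j {f} → j < n → (∀ i → i < n → i ≢ j → f i ≡ 0) → Σ< n f ≡ f j
Σ<-single (suc n) j {f} j<n e with j ≟ n
... | yes refl = trans (cong (f n +_) (Σ<-zero n λ i i<n → e i (m≤n⇒m≤1+n i<n) (<⇒≢ i<n))) (+-identityʳ _)
... | no j≢n = cong₂ _+_ (e n ≤-refl (j≢n ∘ sym))
                         (Σ<-single n j (≤∧≢⇒< (s≤s⁻¹ j<n) j≢n) λ i i<n → e i (m≤n⇒m≤1+n i<n))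

-- A MOD gate fires on the sum 0, so the bit is read from b - 1, with `pred m` standing for -1.
b2n≡∣?-pred : ∀ {m} → 2 ≤ m → ∀ b → b ≡ ⌊ m ∣? (b2n b + pred m) ⌋
b2n≡∣?-pred {suc m} (s≤s 1≤m) true  = sym (⌊⌋-true (suc m ∣? suc m) ∣-refl)
b2n≡∣?-pred {suc m} (s≤s 1≤m) false = sym (⌊⌋-false (suc m ∣? m) λ d → <⇒≱ ≤-refl (∣⇒≤ {{>-nonZero 1≤m}} d))

module Gadgets (m A M K n : ℕ) (2≤m : 2 ≤ m) (m≤A : m ≤ A) (M≤A : M ≤ A) (K<A : K < A)
  {p q} (pp : Prime p) (pq : Prime q) (p<q : p < q) (p∣m : p ∣ m) (q∣m : q ∣ m) where

  -- One fan-in bound for all gates. `A ^ M` pays for the vectors of a conjunction of at most `M`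
  -- bits, or for the monomials of a degree below `M` in `K` bits; the other factors `A` pay for
  -- `m`, primes and numbers of terms.
  W : ℕ
  W = A ^ (5 + M)

  open Formulas m W n public

  private instance
    nzm : NonZero m
    nzm = >-nonZero (<-trans z<s 2≤m)
    nzA : NonZero A
    nzA = >-nonZero (≤-trans (<-trans z<s 2≤m) m≤A)

  Node : ℕ → Set
  Node d = Σ (Vec Bool n → Bool) (Computed d)

  values : ∀ {d} → List (Node d) → Vec Bool n → List Bool
  values gs x = map (λ g → proj₁ g x) gs

  divisorGate : ∀ {p d N s} → p ∣ m → Summed d N s → m * N ≤ W → Computed (suc d) (λ x → ⌊ p ∣? s x ⌋)
  divisorGate {p} {d} {N} {s} p∣m S le =
    gate (Summed-* k S) (≤-trans (*-monoˡ-≤ N (∣⇒≤ (quotient-∣ p∣m))) le)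
         λ x → ⌊⌋-⇔ (p ∣? s x) (m ∣? (k * s x)) (mk⇔
           (λ h → subst (_∣ k * s x) (sym (m∣n⇒n≡quotient*m p∣m)) (*-monoʳ-∣ k h))
           (λ h → *-cancelˡ-∣ k {{quotient≢0 p∣m}} (subst (_∣ k * s x) (m∣n⇒n≡quotient*m p∣m) h)))
    where k = quotient p∣m

  private
    instance
      nzp = prime⇒nonZero pp
      nzq = prime⇒nonZero pq

    p≤A : p ≤ A
    p≤A = ≤-trans (∣⇒≤ p∣m) m≤A

    A^-mono : ∀ {i j} → i ≤ j → A ^ i ≤ A ^ j
    A^-mono = ^-monoʳ-≤ A

    2≤A : 2 ≤ A
    2≤A = ≤-trans 2≤m m≤A

  -- `c` accumulates the products v z chosen so far. Each leaf of the recursion is one MOD_p gate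
  -- over the whole linear form, so all p^k gates stand side by side on one level.
  Summed-zeros : ∀ {d N c} (gs : List (Node d)) → Summed d N c → m * (N + length gs * p) ≤ W →
    Summed (suc d) (p ^ length gs) (λ x → zeros p (values gs x) (c x))
  Summed-zeros {N = N} [] S le = Summed-b2n (divisorGate p∣m S (subst (λ u → m * u ≤ W) (+-identityʳ N) le))
  Summed-zeros {N = N} ((f , F) ∷ gs) S le = Summed-Σ< p λ v v<p →
    Summed-zeros gs
      (Summed-+ S (Summed-≤ (≤-trans (≤-reflexive (*-identityʳ v)) (<⇒≤ v<p)) (Summed-* v (Summed-b2n F))))
      (subst (λ u → m * u ≤ W) (sym (+-assoc N p _)) le)

  Computed-none : ∀ {d} (gs : List (Node d)) → length gs ≤ M → Computed (2 + d) (λ x → none (values gs x))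
  Computed-none {d} gs len =
    Computed-cong (λ x → trans (none-zeros pp pq p<q (values gs x))
                         (cong (λ u → ⌊ q ∣? (zeros p (values gs x) 0 + pred q * p ^ u) ⌋) (length-map _ gs)))
      (divisorGate q∣m (Summed-+ (Summed-zeros gs (Summed-const 0) le₁) (Summed-const (pred q * p ^ L))) le₂)
    where
    open ≤-Reasoning
    L = length gs
    le₁ : m * (L * p) ≤ W
    le₁ = begin
      m * (L * p)            ≤⟨ *-mono-≤ m≤A (*-mono-≤ (≤-trans len M≤A) p≤A) ⟩
      A * (A * A)            ≡⟨ cong (λ u → A * (A * u)) (*-identityʳ A) ⟨
      A ^ 3                  ≤⟨ A^-mono {3} {5 + M} (s≤s (s≤s (s≤s z≤n))) ⟩
      W                      ∎
    le₂ : m * (p ^ L + pred q * p ^ L) ≤ W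
    le₂ = begin
      m * (p ^ L + pred q * p ^ L) ≡⟨ cong (λ u → m * (u * p ^ L)) (suc-pred q) ⟩
      m * (q * p ^ L)              ≤⟨ *-mono-≤ m≤A (*-mono-≤ (≤-trans (∣⇒≤ q∣m) m≤A) (≤-trans (^-monoˡ-≤ L p≤A) (A^-mono len))) ⟩
      A * (A * A ^ M)              ≤⟨ A^-mono {2 + M} {5 + M} (+-monoˡ-≤ M {2} {5} (s≤s (s≤s z≤n))) ⟩
      W                            ∎

  Computed-not : ∀ {d f} → Computed d f → Computed (suc d) (not ∘ f)
  Computed-not {f = f} F = gate (Summed-b2n F) (m^n>0 A (5 + M)) λ x → lemma (f x)
    where
    lemma : ∀ b → not b ≡ ⌊ m ∣? b2n b ⌋
    lemma true  = sym (⌊⌋-false (m ∣? 1) λ d → <⇒≢ 2≤m (sym (∣1⇒≡1 d)))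
    lemma false = sym (⌊⌋-true (m ∣? 0) (m ∣0))

  -- De Morgan: the negations take one level and `none` two more.
  Computed-and : ∀ {d} (gs : List (Node d)) → length gs ≤ M → Computed (3 + d) (λ x → and (values gs x))
  Computed-and gs len = Computed-cong
    (λ x → trans (sym (none-not (values gs x))) (cong none (trans (sym (map-∘ gs)) (map-∘ gs))))
    (Computed-none (map (λ g → not ∘ proj₁ g , Computed-not (proj₂ g)) gs) (≤-trans (≤-reflexive (length-map _ gs)) len))

  -- The elementary symmetric polynomial of degree i in gs, a sum of conjunctions, times those of acc.
  Summed-C : ∀ {d} i (acc gs : List (Node d)) → length acc + i ≤ M →
    Summed (3 + d) (suc (length gs) ^ i) (λ x → b2n (and (values acc x)) * (count (values gs x) choose i))
  Summed-C zero acc gs len = Summed-cong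
    (λ x → trans (cong (b2n (and (values acc x)) *_) (nC0≡1 (count (values gs x)))) (*-identityʳ _))
    (Summed-b2n (Computed-and acc (subst (_≤ M) (+-identityʳ _) len)))
  Summed-C (suc i) acc [] len = empty λ x →
    trans (cong (b2n (and (values acc x)) *_) (k>n⇒nCk≡0 {0} {suc i} z<s)) (*-zeroʳ (b2n (and (values acc x))))
  Summed-C (suc i) acc (g ∷ gs) len =
    Summed-≤ size (Summed-cong (λ x → pascal (proj₁ g x) (b2n (and (values acc x))) (and (values acc x)) refl (count (values gs x)))
      (Summed-+ (Summed-C (suc i) acc gs len)
                (Summed-C i (g ∷ acc) gs (≤-trans (≤-reflexive (sym (+-suc (length acc) i))) len))))
    where
    pascal : ∀ b a a′ → a ≡ b2n a′ → ∀ c → a * ((b2n b + c) choose suc i) ≡ a * (c choose suc i) + b2n (b ∧ a′) * (c choose i)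
    pascal true  a a′ refl c = trans (cong (a *_) (trans (sym (nCk+nC[k+1]≡[n+1]C[k+1] c i)) (+-comm (c choose i) _)))
                                     (*-distribˡ-+ a (c choose suc i) (c choose i))
    pascal false a a′ refl c = sym (+-identityʳ _)
    l = suc (length gs)
    size : l * l ^ i + l ^ i ≤ suc l * suc l ^ i
    size = ≤-trans (≤-reflexive (+-comm (l * l ^ i) (l ^ i))) (*-monoʳ-≤ (suc l) (^-monoˡ-≤ i (n≤1+n l)))

  -- Each binomial of the count is an elementary symmetric polynomial with at most (1 + K)^i ≤ A^M
  -- summands, and its coefficient is their multiplicity. The bound on `g` passes to `Δ r g`, whose
  -- values are remainders modulo `r`.
  Summed-newton : ∀ {d} r .{{_ : NonZero r}} N i g (gs : List (Node d)) → length gs ≤ K → i + N ≤ M → (∀ s → g s ≤ r) →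
    Summed (3 + d) (N * (r * A ^ M)) (λ x → newton r N i g (count (values gs x)))
  Summed-newton r zero    i g gs len iN g≤ = empty λ _ → refl
  Summed-newton r (suc N) i g gs len iN g≤ = Summed-+
    (Summed-≤ size (Summed-cong (λ x → cong (g 0 *_) (sym (*-identityˡ _))) (Summed-* (g 0) (Summed-C i [] gs (≤-trans (m≤m+n i _) iN)))))
    (Summed-newton r N (suc i) (Δ r g) gs len (≤-trans (≤-reflexive (sym (+-suc i N))) iN) (λ s → m%n≤n _ r))
    where
    size : g 0 * suc (length gs) ^ i ≤ r * A ^ M
    size = *-mono-≤ (g≤ 0) (≤-trans (^-monoˡ-≤ i (≤-trans (s≤s len) K<A)) (A^-mono (≤-trans (m≤m+n i _) iN)))

  -- The indicator of the residue has period r^e in the count, so its Newton sum with r^e terms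
  -- agrees with it modulo `r` everywhere. That suffices, because the gate adds `pred r` and tests
  -- divisibility by `r`.
  Computed-residue : ∀ {d r} → Prime r → r ∣ m → ∀ e → r ^ e ≤ M → ∀ t (gs : List (Node d)) → length gs ≤ K →
    Computed (4 + d) (λ x → ⌊ (r ^ e) ∣? ∣ count (values gs x) - t ∣ ⌋)
  Computed-residue {d} {r} pr r∣m e D≤M t gs len = Computed-cong spec
    (divisorGate r∣m (Summed-+ (Summed-newton r (r ^ e) 0 g gs len D≤M
      (λ s → ≤-trans (b2n≤1 (φ s)) (>-nonZero⁻¹ r))) (Summed-const (pred r))) le)
    where
    instance _ = prime⇒nonZero pr
    instance _ = m^n≢0 r e
    φ : ℕ → Bool
    φ s = ⌊ (r ^ e) ∣? ∣ s - t ∣ ⌋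
    g : ℕ → ℕ
    g s = b2n (φ s)
    spec : ∀ x → φ (count (values gs x)) ≡ ⌊ r ∣? (newton r (r ^ e) 0 g (count (values gs x)) + pred r) ⌋
    spec x = trans (b2n≡∣?-pred (nonTrivial⇒n>1 r {{prime⇒nonTrivial pr}}) (φ s))
      (∣?-cong-% {r} (+-cong-% {r} {g s} {newton r (r ^ e) 0 g s} {pred r}
        (sym (trans (newton-periodic pr e g s) (cong (λ b → b2n b % r) (∣?-∣-∣-cong {r ^ e} t (m%n%n≡m%n s (r ^ e)))))) refl))
      where s = count (values gs x)
    r≤A : r ≤ A
    r≤A = ≤-trans (∣⇒≤ r∣m) m≤A
    open ≤-Reasoning
    le : m * (r ^ e * (r * A ^ M) + pred r) ≤ W
    le = begin
      m * (r ^ e * (r * A ^ M) + pred r)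
        ≤⟨ *-mono-≤ m≤A (+-mono-≤ (*-mono-≤ (≤-trans D≤M M≤A) (*-monoˡ-≤ (A ^ M) r≤A)) (≤-trans pred[n]≤n r≤A)) ⟩
      A * (A * (A * A ^ M) + A)
        ≤⟨ *-monoʳ-≤ A (+-monoʳ-≤ (A ^ (2 + M)) (≤-trans (≤-reflexive (sym (*-identityʳ A))) (A^-mono {1} {2 + M} (s≤s z≤n)))) ⟩
      A * (A ^ (2 + M) + A ^ (2 + M))     ≡⟨ cong (λ u → A * (A ^ (2 + M) + u)) (+-identityʳ _) ⟨
      A * (2 * A ^ (2 + M))               ≤⟨ *-monoʳ-≤ A (*-monoˡ-≤ (A ^ (2 + M)) 2≤A) ⟩
      A ^ (4 + M)                         ≤⟨ A^-mono (n≤1+n (4 + M)) ⟩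
      W                                   ∎

  -- The events S = t for t ≤ B are disjoint, so a plain sum over t recovers φ ∘ S.
  module Interpolation {d} (S : Vec Bool n → ℕ) (B : ℕ) (S≤B : ∀ x → S x ≤ B) (B<A : B < A) (ds : List ℕ) (ds≤M : length ds ≤ M)
    (coprime : AllPairs Coprime ds) (B<Πds : B < product ds)
    (residue : All (λ D → ∀ t → Computed d (λ x → ⌊ D ∣? ∣ S x - t ∣ ⌋)) ds) (φ : ℕ → Bool) where

    private
      tests : ∀ {ds} → All (λ D → ∀ t → Computed d (λ x → ⌊ D ∣? ∣ S x - t ∣ ⌋)) ds → ℕ → List (Node d)
      tests []                 t = []
      tests (_∷_ {x = D} R Rs) t = ((λ x → ⌊ D ∣? ∣ S x - t ∣ ⌋) , R t) ∷ tests Rs t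

      length-tests : ∀ {ds} (Rs : All _ ds) t → length (tests Rs t) ≡ length ds
      length-tests []       t = refl
      length-tests (R ∷ Rs) t = cong suc (length-tests Rs t)

      tests-pass : ∀ {ds} (Rs : All _ ds) t x → S x ≡ t → and (values (tests Rs t) x) ≡ true
      tests-pass []       t x e = refl
      tests-pass (_∷_ {x = D} R Rs) t x e
        rewrite ⌊⌋-true (D ∣? ∣ S x - t ∣) (subst (D ∣_) (sym (m≡n⇒∣m-n∣≡0 e)) (D ∣0)) = tests-pass Rs t x e

      tests-sound : ∀ {ds} (Rs : All _ ds) t x → and (values (tests Rs t) x) ≡ true → All (_∣ ∣ S x - t ∣) ds
      tests-sound []       t x e = []
      tests-sound (_∷_ {x = D} R Rs) t x e with D ∣? ∣ S x - t ∣
      ... | yes h = h ∷ tests-sound Rs t x e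

      term : ℕ → Vec Bool n → Bool
      term t x = φ t ∧ and (values (tests residue t) x)

      Computed-term : ∀ t → Computed (3 + d) (term t)
      Computed-term t with φ t
      ... | false = const false λ _ → refl
      ... | true  = Computed-and (tests residue t) (≤-trans (≤-reflexive (length-tests residue t)) ds≤M)

      small-multiple : ∀ {D k} → D ∣ k → k < D → k ≡ 0
      small-multiple {k = zero}  _ _  = refl
      small-multiple {k = suc k} d lt = ⊥-elim (<⇒≱ lt (∣⇒≤ d))

      -- If all tests pass, the coprime `ds` divide |S x - t|, and so does their product. The
      -- product exceeds `B`, which bounds the difference, so the difference is 0.
      term-≢ : ∀ t x → t ≤ B → t ≢ S x → b2n (term t x) ≡ 0
      term-≢ t x t≤B ne with φ t
      ... | false = refl
      ... | true with and (values (tests residue t) x) in e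
      ... | false = refl
      ... | true  = ⊥-elim (ne (sym (∣m-n∣≡0⇒m≡n (small-multiple
              (product∣ coprime (tests-sound residue t x e))
              (≤-<-trans (≤-trans (∣m-n∣≤m⊔n (S x) t) (⊔-lub (S≤B x) t≤B)) B<Πds)))))

      term-≡ : ∀ x → term (S x) x ≡ φ (S x)
      term-≡ x with φ (S x)
      ... | false = refl
      ... | true  = tests-pass residue (S x) x refl

    total : Vec Bool n → ℕ
    total x = Σ< (suc B) (λ t → b2n (term t x)) + pred m

    -- Kept apart from its gate, because the output gate of the final circuit is built from this sum
    -- directly.
    Summed-total : Summed (3 + d) (suc B * 1 + pred m) total
    Summed-total = Summed-+ (Summed-Σ< (suc B) λ t _ → Summed-b2n (Computed-term t)) (Summed-const (pred m))

    total≤W : suc B * 1 + pred m ≤ W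
    total≤W = begin
      suc B * 1 + pred m ≤⟨ +-mono-≤ (≤-trans (≤-reflexive (*-identityʳ (suc B))) B<A) (≤-trans pred[n]≤n m≤A) ⟩
      A + A              ≡⟨ cong (A +_) (+-identityʳ A) ⟨
      2 * A              ≤⟨ *-monoˡ-≤ A 2≤A ⟩
      A * A              ≡⟨ cong (A *_) (*-identityʳ A) ⟨
      A ^ 2              ≤⟨ A^-mono {2} {5 + M} (s≤s (s≤s z≤n)) ⟩
      W                  ∎
      where open ≤-Reasoning

    total-correct : ∀ x → φ (S x) ≡ ⌊ m ∣? total x ⌋
    total-correct x = trans (b2n≡∣?-pred 2≤m (φ (S x))) (cong (λ u → ⌊ m ∣? (u + pred m) ⌋) (sym
      (trans (Σ<-single (suc B) (S x) (s≤s (S≤B x)) (λ t t<B → term-≢ t x (s≤s⁻¹ t<B))) (cong b2n (term-≡ x)))))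

    Computed-∘ : Computed (4 + d) (λ x → φ (S x))
    Computed-∘ = gate Summed-total total≤W total-correct

  count≤length : ∀ bs → count bs ≤ length bs
  count≤length []       = z≤n
  count≤length (b ∷ bs) = +-mono-≤ (b2n≤1 b) (count≤length bs)

  record GatePrimePower (D : ℕ) : Set where
    field
      base exponent : ℕ
      base-prime    : Prime base
      base∣m        : base ∣ m
      isPower       : D ≡ base ^ exponent
      D≤M           : D ≤ M

  -- Symmetric functions of `K` bits and the counting tree.

  module Symmetrics (ds : List ℕ) (ds≤M : length ds ≤ M) (coprime : AllPairs Coprime ds) (K<Πds : K < product ds)
    (powers : All GatePrimePower ds) where

    -- Four levels give the residues modulo the prime powers in `ds`; four more recover `φ` from
    -- them, since their product exceeds `K`.
    Computed-symmetric : ∀ {d} (gs : List (Node d)) → length gs ≤ K → ∀ φ → Computed (8 + d) (λ x → φ (count (values gs x)))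
    Computed-symmetric gs len φ = Interpolation.Computed-∘ (λ x → count (values gs x)) K
      (λ x → ≤-trans (count≤length (values gs x)) (≤-trans (≤-reflexive (length-map _ gs)) len))
      K<A ds ds≤M coprime K<Πds (All.map residue powers) φ
      where
      residue : ∀ {D} → GatePrimePower D → ∀ t → Computed _ (λ x → ⌊ D ∣? ∣ count (values gs x) - t ∣ ⌋)
      residue record { exponent = e ; base-prime = pr ; base∣m = r∣m ; isPower = refl ; D≤M = D≤M } t =
        Computed-residue pr r∣m e D≤M t gs len

    -- Unary digits of a number below ℓ, so that their sum is that number.
    thermometer : ∀ {d} (gs : List (Node d)) → length gs ≤ K → ∀ ℓ .{{_ : NonZero ℓ}} → ℕ → List (Node (8 + d))
    thermometer gs len ℓ zero    = []
    thermometer gs len ℓ (suc u) =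
      (_ , Computed-symmetric gs len (λ s → ⌊ u <? s % ℓ ⌋)) ∷ thermometer gs len ℓ u

    length-thermometer : ∀ {d} (gs : List (Node d)) len ℓ .{{_ : NonZero ℓ}} u → length (thermometer gs len ℓ u) ≡ u
    length-thermometer gs len ℓ zero    = refl
    length-thermometer gs len ℓ (suc u) = cong suc (length-thermometer gs len ℓ u)

    -- `u` is general for the sake of induction; at u = ℓ the minimum is the residue itself.
    count-thermometer : ∀ {d} (gs : List (Node d)) len ℓ .{{_ : NonZero ℓ}} u x →
      count (values (thermometer gs len ℓ u) x) ≡ u ⊓ (count (values gs x) % ℓ)
    count-thermometer gs len ℓ zero    x = refl
    count-thermometer gs len ℓ (suc u) x = trans (cong (_ +_) (count-thermometer gs len ℓ u x)) (step (count (values gs x) % ℓ))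
      where
      step : ∀ v → b2n ⌊ u <? v ⌋ + u ⊓ v ≡ suc u ⊓ v
      step v with u <? v
      ... | yes u<v = trans (cong suc (m≤n⇒m⊓n≡m (<⇒≤ u<v))) (sym (m≤n⇒m⊓n≡m u<v))
      ... | no  u≮v = trans (m≥n⇒m⊓n≡n (≮⇒≥ u≮v)) (sym (m≥n⇒m⊓n≡n (m≤n⇒m≤1+n (≮⇒≥ u≮v))))

    values-++ : ∀ {d} (gs hs : List (Node d)) x → count (values (gs ++ hs) x) ≡ count (values gs x) + count (values hs x)
    values-++ gs hs x = trans (cong count (map-++ _ gs hs))
      (trans (cong sum (map-++ b2n (values gs x) (values hs x))) (sum-++ (map b2n (values gs x)) _))

    module Reduction (B ℓ : ℕ) .{{_ : NonZero ℓ}} (Bℓ≤K : B * ℓ ≤ K) where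

      record Reduced {d} (d′ N : ℕ) (gs : List (Node d)) : Set where
        constructor reduced
        field
          nodes  : List (Node d′)
          length≤ : length nodes ≤ N
          count≡  : ∀ x → count (values nodes x) % ℓ ≡ count (values gs x) % ℓ

      blocks : ∀ {d d′ L} → ((gs : List (Node d)) → length gs ≤ L → Reduced d′ ℓ gs) →
        ∀ k (gs : List (Node d)) → length gs ≤ k * L → Reduced d′ (k * ℓ) gs
      blocks reduceBlock zero    []  len = reduced [] z≤n λ _ → refl
      blocks {L = L} reduceBlock (suc k) gs len
        with reduced hs hlen h≡ ← reduceBlock (List.take L gs) (≤-trans (≤-reflexive (length-take L gs)) (m⊓n≤m L _))
        with reduced is ilen i≡ ← blocks reduceBlock k (List.drop L gs)
               (≤-trans (≤-reflexive (length-drop L gs)) (≤-trans (∸-monoˡ-≤ L len) (≤-reflexive (m+n∸m≡n L (k * L))))) =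
        reduced (hs ++ is) (≤-trans (≤-reflexive (length-++ hs)) (+-mono-≤ hlen ilen)) λ x → begin
          count (values (hs ++ is) x) % ℓ
            ≡⟨ cong (_% ℓ) (values-++ hs is x) ⟩
          (count (values hs x) + count (values is x)) % ℓ
            ≡⟨ +-cong-% {ℓ} {count (values hs x)} {count (values (List.take L gs) x)} (h≡ x) (i≡ x) ⟩
          (count (values (List.take L gs) x) + count (values (List.drop L gs) x)) % ℓ
            ≡⟨ cong (_% ℓ) (values-++ (List.take L gs) (List.drop L gs) x) ⟨
          count (values (List.take L gs ++ List.drop L gs) x) % ℓ
            ≡⟨ cong (λ hs → count (values hs x) % ℓ) (take++drop≡id L gs) ⟩
          count (values gs x) % ℓ ∎
        where open ≡-Reasoning

      -- The `B` subtrees yield at most `ℓ` bits each. These B ℓ ≤ K bits are within reach of one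
      -- more layer of symmetric functions, which writes the residue of their count again as `ℓ`
      -- unary bits. A single leaf fits because ℓ ≥ 1.
      reduce : ∀ {d} j (gs : List (Node d)) → length gs ≤ B ^ j → Reduced (j * 8 + d) ℓ gs
      reduce zero    gs len = reduced gs (≤-trans len (>-nonZero⁻¹ ℓ)) λ _ → refl
      reduce (suc j) gs len with reduced hs hlen h≡ ← blocks (reduce j) B gs len =
        reduced (thermometer hs hlen′ ℓ ℓ) (≤-reflexive (length-thermometer hs hlen′ ℓ ℓ)) λ x →
          trans (cong (_% ℓ) (trans (count-thermometer hs hlen′ ℓ ℓ x) (m≥n⇒m⊓n≡n (m%n≤n _ ℓ))))
                (trans (m%n%n≡m%n (count (values hs x)) ℓ) (h≡ x))
        where hlen′ = ≤-trans hlen Bℓ≤K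

      Computed-residue-large : ∀ {d} j (gs : List (Node d)) → length gs ≤ B ^ j → ℓ ≤ K → ∀ t →
        Computed (8 + (j * 8 + d)) (λ x → ⌊ ℓ ∣? ∣ count (values gs x) - t ∣ ⌋)
      Computed-residue-large j gs len ℓ≤K t with reduced hs hlen h≡ ← reduce j gs len =
        Computed-cong (λ x → sym (∣?-∣-∣-cong {ℓ} t (h≡ x)))
          (Computed-symmetric hs (≤-trans hlen ℓ≤K) (λ s → ⌊ ℓ ∣? ∣ s - t ∣ ⌋))

    inputNode : Fin n → Node 0
    inputNode i = (λ x → lookup x i) , input i λ _ → refl

    inputs : List (Node 0)
    inputs = List.tabulate inputNode

    count-inputs : ∀ x → count (values inputs x) ≡ ones x
    count-inputs x = trans (cong count (map-tabulate inputNode λ g → proj₁ g x)) (go x)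
      where
      go : ∀ {k} (y : Vec Bool k) → count (List.tabulate (lookup y)) ≡ ones y
      go []          = refl
      go (true ∷ y)  = cong suc (go y)
      go (false ∷ y) = go y

    -- The depth is `h * 8` for the trees, 8 for a residue test at the root, 3 for the terms of the
    -- interpolation and 1 for the output gate.
    symmetricCircuit : ∀ B h (ℓs : List ℕ) → n ≤ B ^ h → n < A → length ℓs ≤ M →
      AllPairs Coprime ℓs → n < product ℓs → All (λ ℓ → NonZero ℓ × ℓ ≤ K × B * ℓ ≤ K) ℓs → ∀ φ →
      Σ ℕ λ k → Σ (Circuit n (suc k)) λ Γ →
        (∀ x → evalMod m Γ x ≡ φ (ones x)) × depth Γ ≤ 12 + h * 8 × suc k ≤ suc W ^ (12 + h * 8)
    symmetricCircuit B h ℓs n≤B^h n<A ℓs≤M cop n<Πℓs bounds φ =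
      subst (λ e → Σ ℕ λ k → Σ (Circuit n (suc k)) λ Γ →
               (∀ x → evalMod m Γ x ≡ φ (ones x)) × depth Γ ≤ 12 + e × suc k ≤ suc W ^ (12 + e))
        (+-identityʳ (h * 8))
        (toCircuit (λ x → φ (ones x)) I.Summed-total I.total≤W
          λ x → trans (cong φ (sym (count-inputs x))) (I.total-correct x))
      where
      count-inputs≤n : ∀ x → count (values inputs x) ≤ n
      count-inputs≤n x = ≤-trans (count≤length (values inputs x))
        (≤-reflexive (trans (length-map _ inputs) (length-tabulate inputNode)))
      residue : ∀ {ℓ} → NonZero ℓ × ℓ ≤ K × B * ℓ ≤ K → ∀ t →
        Computed (8 + (h * 8 + 0)) (λ x → ⌊ ℓ ∣? ∣ count (values inputs x) - t ∣ ⌋)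
      residue {ℓ} (nz , ℓ≤K , Bℓ≤K) = Reduction.Computed-residue-large B ℓ {{nz}} Bℓ≤K h inputs
        (≤-trans (≤-reflexive (length-tabulate inputNode)) n≤B^h) ℓ≤K
      residues = All.map residue bounds
      module I = Interpolation (λ x → count (values inputs x)) n count-inputs≤n n<A ℓs ℓs≤M cop n<Πℓs residues φ

-- Integer roots, coprime bases and powers of prescribed size.

integerRoot : ∀ k .{{_ : NonZero k}} n → Σ ℕ λ i → i ^ k ≤ n × n < suc i ^ k
integerRoot (suc k) zero    = 0 , z≤n , m^n>0 1 (suc k)
integerRoot k       (suc n) with i , i^k≤n , n< ← integerRoot k n with suc n <? suc i ^ k
... | yes lt = i , m≤n⇒m≤1+n i^k≤n , lt
... | no  ge = suc i , ≮⇒≥ ge , ≤-<-trans n< (^-monoˡ-< k ≤-refl)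

positiveRoot : ∀ k .{{_ : NonZero k}} n → 1 ≤ n → Σ ℕ λ i → 1 ≤ i × i ^ k ≤ n × n < suc i ^ k
positiveRoot k n 1≤n with integerRoot k n
... | zero  , _  , lt = ⊥-elim (<⇒≱ (subst (n <_) (^-zeroˡ k) lt) 1≤n)
... | suc i , le , lt = suc i , s≤s z≤n , le , lt

n≤2^n : ∀ n → n ≤ 2 ^ n
n≤2^n zero    = z≤n
n≤2^n (suc n) = +-mono-≤ (m^n>0 2 n) (≤-trans (n≤2^n n) (m≤m+n _ 0))

-- Sylvester's sequence 2, 3, 7, 43, ..., by Euclid's argument. It depends on `h` alone, so its
-- product enters only the constants.
coprimeBases : ∀ h → Σ (List ℕ) λ bs → length bs ≡ h × AllPairs Coprime bs × All (2 ≤_) bs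
coprimeBases zero    = [] , refl , [] , []
coprimeBases (suc h) with bs , len , cop , ge ← coprimeBases h =
  suc (product bs) ∷ bs , cong suc len , All.tabulate euclid ∷ cop ,
  s≤s (>-nonZero⁻¹ _ {{product≢0 (All.map (λ le → >-nonZero (<-trans z<s le)) ge)}}) ∷ ge
  where
  euclid : ∀ {b} → b ∈ bs → Coprime (suc (product bs)) b
  euclid b∈bs {d} (d∣1+Π , d∣b) = ∣1⇒≡1 (∣m+n∣m⇒∣n (subst (d ∣_) (+-comm 1 (product bs)) d∣1+Π) (∣-trans d∣b (∈⇒∣product b∈bs)))

-- The exponent grows only when the target overtakes b^e, and the next power then overshoots by at
-- most the factor `b`.
powerBetween : ∀ {b} → 2 ≤ b → ∀ Y → Σ ℕ λ e → suc Y ≤ b ^ e × b ^ e ≤ b * suc Y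
powerBetween {b} 2≤b zero    = 0 , ≤-refl , ≤-trans (<-trans z<s 2≤b) (≤-reflexive (sym (*-identityʳ b)))
powerBetween {b} 2≤b (suc Y) with e , lo , hi ← powerBetween 2≤b Y with suc (suc Y) ≤? b ^ e
... | yes le = e , le , ≤-trans hi (*-monoʳ-≤ b (n≤1+n (suc Y)))
... | no  gt = suc e , (begin
    2 + Y         ≤⟨ +-monoˡ-≤ (suc Y) (s≤s (z≤n {Y})) ⟩
    suc Y + suc Y ≡⟨ cong (suc Y +_) (+-identityʳ (suc Y)) ⟨
    2 * suc Y     ≤⟨ *-mono-≤ 2≤b lo ⟩
    b * b ^ e     ∎) ,
    *-monoʳ-≤ b (≤-trans (s≤s⁻¹ (≰⇒> gt)) (n≤1+n (suc Y)))
  where open ≤-Reasoning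

-- Only meaningful for b ≥ 2.
exponent : ℕ → ℕ → ℕ
exponent Y b with 2 ≤? b
... | yes 2≤b = proj₁ (powerBetween 2≤b (pred Y))
... | no  _   = 0

exponent-spec : ∀ Y .{{_ : NonZero Y}} {b} → 2 ≤ b → Y ≤ b ^ exponent Y b × b ^ exponent Y b ≤ b * Y
exponent-spec (suc Y) {b} 2≤b with 2 ≤? b
... | yes 2≤b′ = proj₂ (powerBetween 2≤b′ Y)
... | no  ¬2≤b = contradiction 2≤b ¬2≤b

powers : ℕ → List ℕ → List ℕ
powers Y = map λ b → b ^ exponent Y b

powers-coprime : ∀ Y {bs} → AllPairs Coprime bs → AllPairs Coprime (powers Y bs)
powers-coprime Y cop = AllPairs.map⁺
  (AllPairs.map {R = Coprime} {S = λ a b → Coprime (a ^ exponent Y a) (b ^ exponent Y b)}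
    (λ {a} {b} c → coprime-^ c (exponent Y a) (exponent Y b)) cop)

^length≤product-powers : ∀ Y .{{_ : NonZero Y}} {bs} → All (2 ≤_) bs → Y ^ length bs ≤ product (powers Y bs)
^length≤product-powers Y []       = ≤-refl
^length≤product-powers Y (b ∷ bs) = *-mono-≤ (proj₁ (exponent-spec Y b)) (^length≤product-powers Y bs)

-- Representatives of each weight and the primes dividing `m`.

ones≤n : ∀ {n} (x : Vec Bool n) → ones x ≤ n
ones≤n []          = z≤n
ones≤n (true ∷ x)  = s≤s (ones≤n x)
ones≤n (false ∷ x) = m≤n⇒m≤1+n (ones≤n x)

firstOnes : ∀ n → ℕ → Vec Bool n
firstOnes zero    t       = []
firstOnes (suc n) zero    = false ∷ firstOnes n zero
firstOnes (suc n) (suc t) = true ∷ firstOnes n t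

ones-firstOnes : ∀ n t → t ≤ n → ones (firstOnes n t) ≡ t
ones-firstOnes zero    zero    _        = refl
ones-firstOnes (suc n) zero    _        = ones-firstOnes n zero z≤n
ones-firstOnes (suc n) (suc t) (s≤s le) = cong suc (ones-firstOnes n t le)

unique-primes-coprime : ∀ {ps} → All Prime ps → AllPairs _≢_ ps → AllPairs Coprime ps
unique-primes-coprime [] [] = []
unique-primes-coprime {p ∷ _} (pp ∷ pps) (ne ∷ nes) =
  All.map {Q = Coprime p} (λ { (pq , p≢q) → ∤⇒coprime pp λ p∣q → p≢q (prime∣prime⇒≡ pp pq p∣q) }) (All.zip (pps , ne))
  ∷ unique-primes-coprime pps nes

-- For m = 0 every prime would be listed, contrary to Euclid.
factorCount⇒nonZero : ∀ {m r} → HasPrimeFactorCount m r → NonZero m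
factorCount⇒nonZero {suc m} _ = _
factorCount⇒nonZero {zero} (ps , _ , _ , iff) = ⊥-elim (go factors refl factorsPrime)
  where
  primes : All Prime ps
  primes = All.tabulate λ {p} p∈ → proj₁ (Equivalence.to (iff p) p∈)
  open PrimeFactorisation (factorise (suc (product ps))) using (factors; isFactorisation; factorsPrime)
  go : ∀ qs → qs ≡ factors → All Prime qs → _
  go [] e _ = ≢-nonZero⁻¹ (product ps) {{productOfPrimes≢0 primes}}
    (suc-injective (trans isFactorisation (cong product (sym e))))
  go (q ∷ qs) e (pq ∷ _) = <⇒≢ (nonTrivial⇒n>1 q {{prime⇒nonTrivial pq}})
    (sym (∣1⇒≡1 (∣m+n∣m⇒∣n (subst (q ∣_) (+-comm 1 (product ps)) q∣1+Π)
                             (∈⇒∣product (Equivalence.from (iff q) (pq , q ∣0))))))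
    where
    q∣1+Π : q ∣ suc (product ps)
    q∣1+Π = subst (q ∣_) (sym (trans isFactorisation (cong product (sym e)))) (m∣m*n (product qs))

two-prime-factors : ∀ {m r} → HasPrimeFactorCount m r → 2 ≤ r →
  Σ ℕ λ p → Σ ℕ λ q → Prime p × Prime q × p < q × p ∣ m × q ∣ m
two-prime-factors (p ∷ q ∷ ps , (p≢q ∷ _) ∷ _ , _ , iff) 2≤r
  with pp , p∣m ← Equivalence.to (iff p) (here refl)
  with pq , q∣m ← Equivalence.to (iff q) (there (here refl))
  with <-cmp p q
... | tri< p<q _ _ = p , q , pp , pq , p<q , p∣m , q∣m
... | tri≈ _ p≡q _ = contradiction p≡q p≢q
... | tri> _ _ q<p = q , p , pq , pp , q<p , q∣m , p∣m
two-prime-factors ([] , _ , refl , _) ()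
two-prime-factors (_ ∷ [] , _ , refl , _) (s≤s ())

-- The tree with `h` layers must fit into depth `d`, while the size bound wants 8h ≥ d - 24.
-- Dividing d - 25 by 8 and adding 1 gives both, and h ≥ 1.
levels : ∀ d → 25 ≤ d → Σ ℕ λ h → 1 ≤ h × 12 + h * 8 ≤ d × d ∸ 24 ≤ 8 * h
levels d 25≤d = suc (d′ / 8) , s≤s z≤n ,
  (begin
    20 + d′ / 8 * 8 ≤⟨ +-mono-≤ (m≤m+n 20 5) (m/n*n≤m d′ 8) ⟩
    25 + d′         ≡⟨ m+[n∸m]≡n 25≤d ⟩
    d               ∎) ,
  (begin
    d ∸ 24                    ≡⟨ cong (_∸ 24) (m+[n∸m]≡n 25≤d) ⟨
    suc d′                    ≡⟨ cong suc (m≡m%n+[m/n]*n d′ 8) ⟩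
    suc (d′ % 8) + d′ / 8 * 8 ≤⟨ +-monoˡ-≤ (d′ / 8 * 8) (m%n<n d′ 8) ⟩
    suc (d′ / 8) * 8          ≡⟨ *-comm (suc (d′ / 8)) 8 ⟩
    8 * suc (d′ / 8)          ∎)
  where
  open ≤-Reasoning
  d′ = d ∸ 25

-- Choice of parameters, circuit size and the exponent of `n`.

module Construction (d m r : ℕ) (factors : HasPrimeFactorCount m r) (2≤r : 2 ≤ r) (h : ℕ) (1≤h : 1 ≤ h) (h≤d : 12 + h * 8 ≤ d) where

  private
    ps  = proj₁ factors
    iff = proj₂ (proj₂ (proj₂ factors))

    bases = proj₁ (coprimeBases h)

    primes : All Prime ps
    primes = All.tabulate λ {p} p∈ → proj₁ (Equivalence.to (iff p) p∈)

    bases≥2 : All (2 ≤_) bases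
    bases≥2 = proj₂ (proj₂ (proj₂ (coprimeBases h)))

    basesNonZero : All NonZero bases
    basesNonZero = All.map (λ le → >-nonZero (<-trans z<s le)) bases≥2

    a = pred r
    β = product bases

    1≤a : 1 ≤ a
    1≤a = s≤s⁻¹ (≤-trans 2≤r (≤-reflexive (sym (suc-pred r {{>-nonZero (<-trans z<s 2≤r)}}))))

    r≡1+a : suc a ≡ r
    r≡1+a = suc-pred r {{>-nonZero (<-trans z<s 2≤r)}}

    instance
      nzm = factorCount⇒nonZero factors
      nzβ = product≢0 basesNonZero
      nza = >-nonZero 1≤a
      nzh = >-nonZero 1≤h
      nzah = m*n≢0 a h

    1≤β : 1 ≤ β
    1≤β = >-nonZero⁻¹ β

    -- `G` dominates all constants. `T` is a degree: K < (G j)^(2r) and n < j^(ah), so (G j)^T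
    -- exceeds both.
    G = m * β + r + h
    T = 2 * r + a * h

    mβ≤G : m * β ≤ G
    mβ≤G = ≤-trans (m≤m+n (m * β) r) (m≤m+n _ h)
    r≤G : r ≤ G
    r≤G = ≤-trans (m≤n+m r (m * β)) (m≤m+n _ h)
    h≤G : h ≤ G
    h≤G = m≤n+m h (m * β + r)
    m≤G : m ≤ G
    m≤G = ≤-trans (m≤m*n m β) mβ≤G
    β≤G : β ≤ G
    β≤G = ≤-trans (m≤n*m β m) mβ≤G

  -- The bracket bounds log₂(1 + W) / j³, and raising 1 + W to the power `d` contributes the factor
  -- `d`. Nothing here depends on `n` or `j`.
  exponentConstant : ℕ
  exponentConstant = (1 + G * T * (5 + G)) * d

  module _ (n j : ℕ) (2≤j : 2 ≤ j) (n<j^ah : n < j ^ (a * h)) where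

    private
      instance
        nzj : NonZero j
        nzj = >-nonZero (<-trans z<s 2≤j)
        nzjj = m*n≢0 j j

      -- `X` is the arity of the tree and the moduli are at most βX, whence `K`. The prime powers
      -- lie between `Y` and mY ≤ M.
      X = j ^ a
      K = X * (β * X)
      Y = β * (j * j)
      A = (G * j) ^ T
      M = G * (j * j)

      instance
        nzX = m^n≢0 j a
        nzY = m*n≢0 β (j * j)
        nzG : NonZero G
        nzG = >-nonZero (≤-trans 1≤β β≤G)
        nzGj = m*n≢0 G j

      moduli = powers X bases
      primePowers = powers Y ps

      open ≤-Reasoning

      n<X^h : n < X ^ h
      n<X^h = <-≤-trans (n<j^ah) (≤-reflexive (sym (^-*-assoc j a h)))

      n<Πmoduli : n < product moduli
      n<Πmoduli = <-≤-trans n<X^h (subst (λ u → X ^ u ≤ product moduli) (proj₁ (proj₂ (coprimeBases h)))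
        (^length≤product-powers X bases≥2))

      modulus-bounds : ∀ {b} → b ∈ bases → let ℓ = b ^ exponent X b in NonZero ℓ × ℓ ≤ K × X * ℓ ≤ K
      modulus-bounds {b} b∈ =
        >-nonZero (≤-trans (>-nonZero⁻¹ X) (proj₁ spec)) ,
        ≤-trans ℓ≤βX (m≤n*m (β * X) X) ,
        *-monoʳ-≤ X ℓ≤βX
        where
        spec = exponent-spec X (All.lookup bases≥2 b∈)
        ℓ≤βX : b ^ exponent X b ≤ β * X
        ℓ≤βX = ≤-trans (proj₂ spec) (*-monoˡ-≤ X (∈⇒≤product basesNonZero b∈))

      -- As r = 1 + a, one factor `Y` remains besides Y^a ≥ (j²)^a. Its `β` matches the one in K = β
      -- (j²)^a, and its j² > 1 makes the inequality strict.
      K<Y^r : K < Y ^ r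
      K<Y^r = subst (λ u → K < Y ^ u) r≡1+a (begin-strict
        X * (β * X)                 ≡⟨ rearrange X β ⟩
        β * (X * X)                 ≡⟨ cong (β *_) (^-distribʳ-* a j j) ⟨
        β * (j * j) ^ a             ≡⟨ *-identityˡ _ ⟨
        1 * (β * (j * j) ^ a)
          <⟨ *-monoˡ-< (β * (j * j) ^ a) {{m*n≢0 β ((j * j) ^ a) {{nzβ}} {{m^n≢0 (j * j) a}}}} (≤-trans 2≤j (m≤m*n j j)) ⟩
        (j * j) * (β * (j * j) ^ a) ≡⟨ rearrange′ (j * j) β ((j * j) ^ a) ⟩
        Y * (j * j) ^ a             ≤⟨ *-monoʳ-≤ Y (^-monoˡ-≤ a (m≤n*m (j * j) β)) ⟩
        Y * Y ^ a                   ∎)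
        where
        rearrange : ∀ x b → x * (b * x) ≡ b * (x * x)
        rearrange = solve-∀
        rearrange′ : ∀ x b y → x * (b * y) ≡ b * x * y
        rearrange′ = solve-∀
        ^-distribʳ-* : ∀ k x y → (x * y) ^ k ≡ x ^ k * y ^ k
        ^-distribʳ-* zero    x y = refl
        ^-distribʳ-* (suc k) x y = trans (cong (x * y *_) (^-distribʳ-* k x y)) (interchange x y (x ^ k) (y ^ k))
          where
          interchange : ∀ x y u v → x * y * (u * v) ≡ x * u * (y * v)
          interchange = solve-∀

      K<Πpowers : K < product primePowers
      K<Πpowers = <-≤-trans K<Y^r (subst (λ u → Y ^ u ≤ product primePowers) (proj₁ (proj₂ (proj₂ factors)))
        (^length≤product-powers Y (All.map (λ pp → nonTrivial⇒n>1 _ {{prime⇒nonTrivial pp}}) primes)))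

      G≤M : G ≤ M
      G≤M = m≤m*n G (j * j)

      Gj^2≤A : (G * j) ^ 2 ≤ A
      Gj^2≤A = ^-monoʳ-≤ (G * j) (≤-trans (m≤n*m 2 r {{>-nonZero (<-trans z<s 2≤r)}})
        (≤-trans (≤-reflexive (*-comm r 2)) (m≤m+n (2 * r) (a * h))))

      M≤[Gj]² : M ≤ (G * j) ^ 2
      M≤[Gj]² = ≤-trans (m≤n*m M G) (≤-reflexive (rearrange G j))
        where
        rearrange : ∀ g j → g * (g * (j * j)) ≡ g * j * (g * j * 1)
        rearrange = solve-∀

      M≤A : M ≤ A
      M≤A = ≤-trans M≤[Gj]² Gj^2≤A

      m≤A : m ≤ A
      m≤A = ≤-trans m≤G (≤-trans G≤M M≤A)

      K<A : K < A
      K<A = begin-strict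
        K                   <⟨ K<Y^r ⟩
        Y ^ r               ≤⟨ ^-monoˡ-≤ r (≤-trans (*-monoˡ-≤ (j * j) β≤G) M≤[Gj]²) ⟩
        ((G * j) ^ 2) ^ r   ≡⟨ ^-*-assoc (G * j) 2 r ⟩
        (G * j) ^ (2 * r)   ≤⟨ ^-monoʳ-≤ (G * j) (m≤m+n (2 * r) (a * h)) ⟩
        A                   ∎

      n<A : n < A
      n<A = begin-strict
        n                   <⟨ n<j^ah ⟩
        j ^ (a * h)         ≤⟨ ^-monoˡ-≤ (a * h) (m≤n*m j G) ⟩
        (G * j) ^ (a * h)   ≤⟨ ^-monoʳ-≤ (G * j) (m≤n+m (a * h) (2 * r)) ⟩
        A                   ∎

    boundedCircuit : (f : Vec Bool n → Bool) → Symmetric f →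
      Σ ℕ λ s → Σ (Circuit n (suc s)) λ Γ → (∀ x → evalMod m Γ x ≡ f x) × depth Γ ≤ d × suc s ≤ 2 ^ (exponentConstant * j ^ 3)
    boundedCircuit f sym-f
      with p , q , pp , pq , p<q , p∣m , q∣m ← two-prime-factors factors 2≤r =
      let 2≤m = ≤-trans (nonTrivial⇒n>1 p {{prime⇒nonTrivial pp}}) (∣⇒≤ p∣m)
          module Ga = Gadgets m A M K n 2≤m m≤A M≤A K<A pp pq p<q p∣m q∣m
          gatePower : ∀ {b} → b ∈ ps → Ga.GatePrimePower (b ^ exponent Y b)
          gatePower {b} b∈ = let pb , b∣m = Equivalence.to (iff b) b∈ in record
            { base = b ; exponent = exponent Y b ; base-prime = pb ; base∣m = b∣m ; isPower = refl
            ; D≤M = ≤-trans (proj₂ (exponent-spec Y (nonTrivial⇒n>1 b {{prime⇒nonTrivial pb}})))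
                (≤-trans (*-monoˡ-≤ Y (∣⇒≤ b∣m)) (≤-trans (≤-reflexive (sym (*-assoc m β (j * j)))) (*-monoˡ-≤ (j * j) mβ≤G))) }
          s , Γ , correct , shallow , small = Ga.Symmetrics.symmetricCircuit primePowers
            (≤-trans (≤-reflexive (trans (length-map _ ps) (proj₁ (proj₂ (proj₂ factors))))) (≤-trans r≤G G≤M))
            (powers-coprime Y (unique-primes-coprime primes (proj₁ (proj₂ factors))))
            K<Πpowers (All.map⁺ (All.tabulate gatePower))
            X h moduli (<⇒≤ n<X^h) n<A
            (≤-trans (≤-reflexive (trans (length-map _ bases) (proj₁ (proj₂ (coprimeBases h))))) (≤-trans h≤G G≤M))
            (powers-coprime X (proj₁ (proj₂ (proj₂ (coprimeBases h)))))
            n<Πmoduli (All.map⁺ (All.tabulate modulus-bounds))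
            -- By symmetry one representative of each weight determines `f`.
            (λ t → f (firstOnes n t))
      in s , Γ ,
         (λ x → trans (correct x) (sym-f _ x (ones-firstOnes n (ones x) (ones≤n x)))) ,
         ≤-trans shallow h≤d ,
         ≤-trans small (size Ga.W refl)
      where
      size : ∀ W → W ≡ A ^ (5 + M) → suc W ^ (12 + h * 8) ≤ 2 ^ (exponentConstant * j ^ 3)
      size W refl = begin
        suc W ^ (12 + h * 8)  ≤⟨ ^-monoʳ-≤ (suc W) h≤d ⟩
        suc W ^ d             ≤⟨ ^-monoˡ-≤ d 1+W≤ ⟩
        (2 ^ ((1 + G * T * (5 + G)) * j ^ 3)) ^ d ≡⟨ ^-*-assoc 2 ((1 + G * T * (5 + G)) * j ^ 3) d ⟩
        2 ^ ((1 + G * T * (5 + G)) * j ^ 3 * d)   ≡⟨ cong (2 ^_) (swap (1 + G * T * (5 + G)) (j ^ 3) d) ⟩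
        2 ^ (exponentConstant * j ^ 3) ∎
        where
        swap : ∀ x y z → x * y * z ≡ x * z * y
        swap = solve-∀
        rearrange : ∀ g t j → 1 * (j * (j * (j * 1))) + g * j * t * (5 * (j * j) + g * (j * j)) ≡ (1 + g * t * (5 + g)) * (j * (j * (j * 1)))
        rearrange = solve-∀
        1+W≤ : suc W ≤ 2 ^ ((1 + G * T * (5 + G)) * j ^ 3)
        1+W≤ = begin
          1 + A ^ (5 + M)                   ≤⟨ +-monoˡ-≤ (A ^ (5 + M)) (m^n>0 A {{m^n≢0 (G * j) T}} (5 + M)) ⟩
          A ^ (5 + M) + A ^ (5 + M)         ≡⟨ cong (A ^ (5 + M) +_) (+-identityʳ (A ^ (5 + M))) ⟨
          -- The crude x ≤ 2^x in place of a logarithm turns j² log j into j³.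
          2 * A ^ (5 + M)                   ≤⟨ *-monoʳ-≤ 2 (^-monoˡ-≤ (5 + M) (^-monoˡ-≤ T (n≤2^n (G * j)))) ⟩
          2 * ((2 ^ (G * j)) ^ T) ^ (5 + M)
            ≡⟨ cong (2 *_) (trans (cong (_^ (5 + M)) (^-*-assoc 2 (G * j) T)) (^-*-assoc 2 (G * j * T) (5 + M))) ⟩
          2 ^ (1 + G * j * T * (5 + M))     ≤⟨ ^-monoʳ-≤ 2 (+-mono-≤ (≤-trans (m^n>0 j 3) (≤-reflexive (sym (*-identityˡ _))))
                                                  (*-monoʳ-≤ (G * j * T) (+-monoˡ-≤ M (m≤m*n 5 (j * j))))) ⟩
          2 ^ (1 * (j ^ 3) + G * j * T * (5 * (j * j) + G * (j * j))) ≡⟨ cong (2 ^_) (rearrange G T j) ⟩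
          2 ^ ((1 + G * T * (5 + G)) * j ^ 3) ∎

-- Were k < i³, then k^(ea) < i^(3ea) ≤ i^(24ah) ≤ n^24. The number 24 = 3 · 8 combines the exponent
-- in j³ with the 8 levels spent on each layer of the tree.
cube≤ : ∀ a h e n i k .{{_ : NonZero a}} .{{_ : NonZero e}} .{{_ : NonZero i}} → i ^ (a * h) ≤ n → e ≤ 8 * h →
  n ^ 24 ≤ k ^ (e * a) → i ^ 3 ≤ k
cube≤ a h e n i k i^ah≤n e≤8h le with i ^ 3 ≤? k
... | yes i³≤k = i³≤k
... | no  k<i³ = contradiction le (<⇒≱ (begin-strict
  k ^ (e * a)           <⟨ ^-monoˡ-< (e * a) {{m*n≢0 e a}} (≰⇒> k<i³) ⟩
  (i ^ 3) ^ (e * a)     ≡⟨ ^-*-assoc i 3 (e * a) ⟩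
  i ^ (3 * (e * a))     ≤⟨ ^-monoʳ-≤ i (≤-trans (*-monoʳ-≤ 3 (*-monoˡ-≤ a e≤8h)) (≤-reflexive (rearrange a h))) ⟩
  i ^ (a * h * 24)      ≡⟨ ^-*-assoc i (a * h) 24 ⟨
  (i ^ (a * h)) ^ 24    ≤⟨ ^-monoˡ-≤ 24 i^ah≤n ⟩
  n ^ 24                ∎))
  where
  open ≤-Reasoning
  rearrange : ∀ a h → 3 * (8 * h * a) ≡ a * h * 24
  rearrange = solve-∀

-- As i ≥ 1, 1 + i ≤ 2i. This passes from the root rounded down to the value j = 1 + i used by the
-- circuit.
[1+i]³≤8k : ∀ i .{{_ : NonZero i}} k → i ^ 3 ≤ k → suc i ^ 3 ≤ 8 * k
[1+i]³≤8k i k i³≤k = begin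
  suc i ^ 3   ≤⟨ ^-monoˡ-≤ 3 (+-monoˡ-≤ i (>-nonZero⁻¹ i)) ⟩
  (i + i) ^ 3 ≡⟨ rearrange i ⟩
  8 * i ^ 3   ≤⟨ *-monoʳ-≤ 8 i³≤k ⟩
  8 * k       ∎
  where
  open ≤-Reasoning
  rearrange : ∀ i → (i + i) * ((i + i) * ((i + i) * 1)) ≡ 8 * (i * (i * (i * 1)))
  rearrange = solve-∀

theorem1p3 : Σ ℕ λ c → 1 ≤ c × (Σ ℕ λ D → c < D × (∀ d → D ≤ d → ∀ m r → HasPrimeFactorCount m r → 2 ≤ r →
    Σ ℕ λ C → Σ ℕ λ N → ∀ n → N ≤ n → ∀ (f : Vec Bool n → Bool) → Symmetric f →
    Σ ℕ λ s → Σ (Circuit n (suc s)) λ circ →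
    (∀ x → evalMod m circ x ≡ f x) × depth circ ≤ d ×
    (∀ k → n ^ c ≤ k ^ ((d ∸ c) * (r ∸ 1)) → suc s ≤ 2 ^ (C * k))))
-- From d = 25 on there is at least one layer, and d - 24 is positive.
theorem1p3 = 24 , s≤s z≤n , 25 , ≤-refl , λ d 25≤d m r factors 2≤r →
  let h , 1≤h , h≤d , d-24≤8h = levels d 25≤d
      E = exponentConstant d m r factors 2≤r h 1≤h h≤d
  -- The factor 8 pays for j = 1 + i; n ≥ 1 makes the root `i` positive.
  in E * 8 , 1 , λ n 1≤n f sym-f →
  let r-1≢0 = >-nonZero (∸-monoˡ-≤ 1 2≤r)
      d-24≢0 = >-nonZero (∸-monoˡ-≤ 24 25≤d)
      i , 1≤i , i^≤n , n<[1+i]^ = positiveRoot ((r ∸ 1) * h) {{m*n≢0 (r ∸ 1) h {{r-1≢0}} {{>-nonZero 1≤h}}}} n 1≤n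
      i≢0 = >-nonZero 1≤i
      -- The circuit needs n < j^(ah) and j ≥ 2, hence j = 1 + i, while the comparison with `k` uses
      -- i^(ah) ≤ n.
      s , circ , correct , shallow , small =
        boundedCircuit d m r factors 2≤r h 1≤h h≤d n (suc i) (s≤s 1≤i) n<[1+i]^ f sym-f
  in s , circ , correct , shallow , λ k le → ≤-trans small (^-monoʳ-≤ 2 (≤-trans
       (*-monoʳ-≤ E ([1+i]³≤8k i {{i≢0}} k (cube≤ (r ∸ 1) h (d ∸ 24) n i k {{r-1≢0}} {{d-24≢0}} {{i≢0}} i^≤n d-24≤8h le)))
       (≤-reflexive (sym (*-assoc E 8 k)))))
  where open Construction
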